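{- Let $N\ge u\ge1$ be real numbers with $N>1$, and let $A\subseteq\{1,\dots,\lfloor N/u\rfloor\}$ be such that $$\sum_{a\in A}\frac1a\ >\ \frac1u+\frac1{\sqrt N-1}.$$ Then there exist a positive integer $k$ and (not necessarily distinct) elements $a_1,\dots,a_k\in A$ such that $N-k<a_1+\dots+a_k\le N$. -}

module Defs where

open import Algebra.Bundles using (CommutativeRing)
import Algebra.Solver.Ring as RingSolver
open import Algebra.Solver.Ring.AlmostCommutativeRing
  using (_-Raw-AlmostCommutative⟶_; fromCommutativeRing)
open import Data.Bool.Base using (if_then_else_)
open import Data.Empty using (⊥; ⊥-elim)
open import Data.Fin.Base using (Fin; toℕ)
open import Data.Fin.Subset using (Subset)
open import Data.Integer.Base as ℤ using (+_; +≤+)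
import Data.Integer.Properties as ℤP
import Data.Maybe.Base as Maybe
open import Data.Nat.Base as ℕ using (ℕ; zero; suc)
import Data.Nat.Properties as ℕP
open import Data.Product using (∃; _×_; _,_; proj₁; proj₂)
open import Data.Rational.Base as ℚ using (ℚ; 0ℚ; 1ℚ; mkℚ; toℚᵘ)
import Data.Rational.Properties as ℚP
import Data.Rational.Unnormalised.Base as ℚᵘ
import Data.Rational.Unnormalised.Properties as ℚᵘP
open import Data.Sum.Base using (_⊎_; inj₁; inj₂; swap)
open import Data.Vec.Base using (lookup)
open import Function.Base using (case_of_)
open import Relation.Binary.Consequences using (dec⇒weaklyDec)
open import Relation.Binary.Definitions using (WeaklyDecidable; tri<; tri≈; tri>)
open import Relation.Binary.PropositionalEquality
open import Relation.Nullary using (yes; no)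

-- Real numbers as two-sided located Dedekind cuts:
-- Lower p means p < x, Upper p means x < p.

record ℝ : Set₁ where
  field
    Lower Upper     : ℚ → Set
    lower-inhabited : ∃ Lower
    upper-inhabited : ∃ Upper
    lower-closed    : ∀ {p q} → p ℚ.< q → Lower q → Lower p
    upper-closed    : ∀ {p q} → p ℚ.< q → Upper p → Upper q
    lower-open      : ∀ {p} → Lower p → ∃ λ q → p ℚ.< q × Lower q
    upper-open      : ∀ {q} → Upper q → ∃ λ p → p ℚ.< q × Upper p
    disjoint        : ∀ {p} → Lower p → Upper p → ⊥
    located         : ∀ {p q} → p ℚ.< q → Lower p ⊎ Upper q

open ℝ

module Lemmas where
  /1-homo : ∀ z → toℚᵘ (z ℚ./ 1) ℚᵘ.≃ ℚᵘ.mkℚᵘ z 0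
  /1-homo z = ℚP.toℚᵘ-fromℚᵘ (ℚᵘ.mkℚᵘ z 0)

  ℤ⟶ℚ : ℤ.+-*-rawRing -Raw-AlmostCommutative⟶ fromCommutativeRing ℚP.+-*-commutativeRing
  ℤ⟶ℚ = record
    { ⟦_⟧    = ℚ._/ 1
    ; +-homo = λ y z → ℚP.toℚᵘ-injective (ℚᵘP.≃-trans (/1-homo (y ℤ.+ z))
        (ℚᵘP.≃-trans (ℚᵘ.*≡* (cong₂ (λ m n → (m ℤ.+ n) ℤ.* + 1)
            (sym (ℤP.*-identityʳ y)) (sym (ℤP.*-identityʳ z))))
          (ℚᵘP.≃-sym (ℚᵘP.≃-trans (ℚP.toℚᵘ-homo-+ (y ℚ./ 1) (z ℚ./ 1))
            (ℚᵘP.+-cong (/1-homo y) (/1-homo z))))))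
    ; *-homo = λ y z → ℚP.toℚᵘ-injective (ℚᵘP.≃-trans (/1-homo (y ℤ.* z))
        (ℚᵘP.≃-sym (ℚᵘP.≃-trans (ℚP.toℚᵘ-homo-* (y ℚ./ 1) (z ℚ./ 1))
          (ℚᵘP.*-cong (/1-homo y) (/1-homo z)))))
    ; -‿homo = λ z → ℚP.toℚᵘ-injective (ℚᵘP.≃-trans (/1-homo (ℤ.- z))
        (ℚᵘP.≃-sym (ℚᵘP.≃-trans (ℚP.toℚᵘ-homo‿- (z ℚ./ 1)) (ℚᵘP.-‿cong (/1-homo z)))))
    ; 0-homo = refl
    ; 1-homo = refl
    }

  -- Identities used below, proved in an arbitrary ring: running the solver
  -- directly on ℚ, whose operations compute, is far too slow.
  module Identities {c ℓ} (R : CommutativeRing c ℓ)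
    (φ : ℤ.+-*-rawRing -Raw-AlmostCommutative⟶ fromCommutativeRing R) where
    open CommutativeRing R using (_≈_; _+_; _*_; _-_; -_) renaming (refl to ≈-refl)

    open _-Raw-AlmostCommutative⟶_ φ using (⟦_⟧)

    ⟦⟧-cong : ∀ {y z} → y ≡ z → ⟦ y ⟧ ≈ ⟦ z ⟧
    ⟦⟧-cong refl = ≈-refl

    coeff≟ : WeaklyDecidable (λ y z → ⟦ y ⟧ ≈ ⟦ z ⟧)
    coeff≟ y z = Maybe.map ⟦⟧-cong (dec⇒weaklyDec ℤP._≟_ y z)

    open RingSolver ℤ.+-*-rawRing (fromCommutativeRing R) φ coeff≟
      using (solve; _:=_; _:+_; _:*_; _:-_; :-_; con)

    one = ⟦ + 1 ⟧

    eq1 : ∀ c e → c * e + e ≈ e * (one + c)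
    eq1 = solve 2 (λ c e → c :* e :+ e := e :* (con (+ 1) :+ c)) ≈-refl

    eq2 : ∀ p c a e → (p + e) * c + ((a - p * c) - c * e) ≈ a
    eq2 = solve 4 (λ p c a e → (p :+ e) :* c :+ ((a :- p :* c) :- c :* e) := a) ≈-refl

    eq3 : ∀ p e → (p - e) + e ≈ p
    eq3 = solve 2 (λ p e → (p :- e) :+ e := p) ≈-refl

    eq4 : ∀ p c a e → a + ((p * c - a) - c * e) ≈ (p - e) * c
    eq4 = solve 4 (λ p c a e → a :+ ((p :* c :- a) :- c :* e) := (p :- e) :* c) ≈-refl

    eq5 : ∀ d m → d + m * d ≈ (one + m) * d
    eq5 = solve 2 (λ d m → d :+ m :* d := (con (+ 1) :+ m) :* d) ≈-refl

    eq6 : ∀ b a d m → (b - (a + d)) + ((d + m) - (b - a)) ≈ m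
    eq6 = solve 4 (λ b a d m → (b :- (a :+ d)) :+ ((d :+ m) :- (b :- a)) := m) ≈-refl

    eq7 : ∀ r → (r - one) + one ≈ r
    eq7 = solve 1 (λ r → (r :- con (+ 1)) :+ con (+ 1) := r) ≈-refl

    eq8 : ∀ a c e p q → (a + e + (c + e)) + ((q - p - (one + one) * e) + (p - (a + c))) ≈ q
    eq8 = solve 5 (λ a c e p q →
      (a :+ e :+ (c :+ e)) :+ ((q :- p :- (con (+ 1) :+ con (+ 1)) :* e) :+ (p :- (a :+ c)))
      := q) ≈-refl

    eq9 : ∀ p → p ≈ - (- p)
    eq9 = solve 1 (λ p → p := :- (:- p)) ≈-refl

    eq10 : ∀ t c a → (- t) * c + (t * c - (- a)) ≈ a
    eq10 = solve 3 (λ t c a → (:- t) :* c :+ (t :* c :- (:- a)) := a) ≈-refl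

    eq11 : ∀ p q c → p * c + (q - p) * c ≈ q * c
    eq11 = solve 3 (λ p q c → p :* c :+ (q :- p) :* c := q :* c) ≈-refl

    eq12 : ∀ r R c d → r * d + (R - r) * (d - c) ≈ r * c + R * (d - c)
    eq12 = solve 4 (λ r R c d →
      r :* d :+ (R :- r) :* (d :- c)
      := r :* c :+ R :* (d :- c)) ≈-refl

    eq13 : ∀ c d e → (d - c) + (c + e - d) ≈ e
    eq13 = solve 3 (λ c d e → (d :- c) :+ (c :+ e :- d) := e) ≈-refl

    eq14 : ∀ q c d P Q e → q * c + (((- q) * c + (Q + P) * e) - (- q) * d) ≈ q * d + (P + Q) * e
    eq14 = solve 6 (λ q c d P Q e →
      q :* c :+ (((:- q) :* c :+ (Q :+ P) :* e) :- (:- q) :* d)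
      := q :* d :+ (P :+ Q) :* e) ≈-refl

    eq15 : ∀ m n t → m + ((n + t) - (m + t)) ≈ n
    eq15 = solve 3 (λ m n t → m :+ ((n :+ t) :- (m :+ t)) := n) ≈-refl

    eq16 : ∀ p q → p * p + ((q - p) * q + p * (q - p)) ≈ q * q
    eq16 = solve 2 (λ p q → p :* p :+ ((q :- p) :* q :+ p :* (q :- p)) := q :* q) ≈-refl

    eq17 : ∀ b B → b + (one + ((B - b) + (B + B * B))) ≈ (one + B) * (one + B)
    eq17 = solve 2 (λ b B →
      b :+ (con (+ 1) :+ ((B :- b) :+ (B :+ B :* B)))
      := (con (+ 1) :+ B) :* (con (+ 1) :+ B)) ≈-refl

    eq18 : ∀ p e s → (p + e) * (p + e) + ((s - p * p - (p + p + one) * e) + e * (one - e)) ≈ s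
    eq18 = solve 3 (λ p e s →
      (p :+ e) :* (p :+ e) :+ ((s :- p :* p :- (p :+ p :+ con (+ 1)) :* e) :+ e :* (con (+ 1) :- e))
      := s) ≈-refl

    eq19 : ∀ p e s → (p + one) * (p + one) + ((s - p * p - (p + p + one) * e)
             + (p + p + one) * (e - one)) ≈ s
    eq19 = solve 3 (λ p e s →
      (p :+ con (+ 1)) :* (p :+ con (+ 1)) :+ ((s :- p :* p :- (p :+ p :+ con (+ 1)) :* e)
        :+ (p :+ p :+ con (+ 1)) :* (e :- con (+ 1)))
      := s) ≈-refl

    eq20 : ∀ q e s → s + ((q * q - s - (q + q) * e) + e * e) ≈ (q - e) * (q - e)
    eq20 = solve 3 (λ q e s →
      s :+ ((q :* q :- s :- (q :+ q) :* e) :+ e :* e)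
      := (q :- e) :* (q :- e)) ≈-refl

    eq21 : ∀ q e s p → s + ((q * q - s - (q + q) * e) + ((q + q) * (e - q) + (q * q + p * p))) ≈ p * p
    eq21 = solve 4 (λ q e s p →
      s :+ ((q :* q :- s :- (q :+ q) :* e) :+ ((q :+ q) :* (e :- q) :+ (q :* q :+ p :* p)))
      := p :* p) ≈-refl

  open Identities ℚP.+-*-commutativeRing ℤ⟶ℚ public

  -- opaque only so that Agda does not unfold these proofs and witnesses
  opaque
    diff : ∀ {p q} → p ℚ.< q → 0ℚ ℚ.< q ℚ.- p
    diff {p} {q} p<q =
      subst (ℚ._< q ℚ.- p) (ℚP.+-inverseʳ p) (ℚP.+-monoˡ-< (ℚ.- p) p<q)

    undiff : ∀ {p q e} → 0ℚ ℚ.< e → p ℚ.+ e ≡ q → p ℚ.< q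
    undiff {p} {q} {e} 0<e refl =
      subst (ℚ._< p ℚ.+ e) (ℚP.+-identityʳ p) (ℚP.+-monoʳ-< p 0<e)

    diff≤ : ∀ {p q} → p ℚ.≤ q → 0ℚ ℚ.≤ q ℚ.- p
    diff≤ {p} {q} p≤q =
      subst (ℚ._≤ q ℚ.- p) (ℚP.+-inverseʳ p) (ℚP.+-monoˡ-≤ (ℚ.- p) p≤q)

    undiff≤ : ∀ {p q e} → 0ℚ ℚ.≤ e → p ℚ.+ e ≡ q → p ℚ.≤ q
    undiff≤ {p} {q} {e} 0≤e refl =
      subst (ℚ._≤ p ℚ.+ e) (ℚP.+-identityʳ p) (ℚP.+-monoʳ-≤ p 0≤e)

    pos* : ∀ {p q} → 0ℚ ℚ.< p → 0ℚ ℚ.< q → 0ℚ ℚ.< p ℚ.* q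
    pos* {p} {q} 0<p 0<q = subst (ℚ._< p ℚ.* q) (ℚP.*-zeroʳ p)
      (ℚP.*-monoʳ-<-pos p ⦃ ℚ.positive 0<p ⦄ 0<q)

    nonNeg* : ∀ {p q} → 0ℚ ℚ.≤ p → 0ℚ ℚ.≤ q → 0ℚ ℚ.≤ p ℚ.* q
    nonNeg* {p} {q} 0≤p 0≤q = subst (ℚ._≤ p ℚ.* q) (ℚP.*-zeroʳ p)
      (ℚP.*-monoˡ-≤-nonNeg p ⦃ ℚ.nonNegative 0≤p ⦄ 0≤q)

    0<1 : 0ℚ ℚ.< 1ℚ
    0<1 = ℚP.positive⁻¹ 1ℚ

    0≤1 : 0ℚ ℚ.≤ 1ℚ
    0≤1 = ℚP.<⇒≤ 0<1

    0≤∣_∣ : ∀ p → 0ℚ ℚ.≤ ℚ.∣ p ∣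
    0≤∣ p ∣ = ℚP.nonNegative⁻¹ ℚ.∣ p ∣ ⦃ ℚP.∣-∣-nonNeg p ⦄

    p≤∣p∣ : ∀ p → p ℚ.≤ ℚ.∣ p ∣
    p≤∣p∣ p with ℚP.∣p∣≡p∨∣p∣≡-p p
    ... | inj₁ eq = ℚP.≤-reflexive (sym eq)
    ... | inj₂ eq with ℚP.≤-total p 0ℚ
    ...   | inj₁ p≤0 = ℚP.≤-trans p≤0 0≤∣ p ∣
    ...   | inj₂ 0≤p = ℚP.≤-reflexive (sym (ℚP.0≤p⇒∣p∣≡p 0≤p))

    -p≤∣p∣ : ∀ p → ℚ.- p ℚ.≤ ℚ.∣ p ∣
    -p≤∣p∣ p = subst (ℚ.- p ℚ.≤_) (ℚP.∣-p∣≡∣p∣ p) (p≤∣p∣ (ℚ.- p))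

    quotient : ∀ a {c} → 0ℚ ℚ.< c → ∃ λ t → t ℚ.* c ≡ a
    quotient a {c} 0<c = a ℚ.* (ℚ.1/ c) , (begin
      a ℚ.* (ℚ.1/ c) ℚ.* c   ≡⟨ ℚP.*-assoc a (ℚ.1/ c) c ⟩
      a ℚ.* (ℚ.1/ c ℚ.* c)   ≡⟨ cong (a ℚ.*_) (ℚP.*-inverseˡ c) ⟩
      a ℚ.* 1ℚ               ≡⟨ ℚP.*-identityʳ a ⟩
      a                      ∎)
      where
      open ≡-Reasoning
      instance
        c≢0 : ℚ.NonZero c
        c≢0 = ℚ.>-nonZero 0<c

    pos-factor : ∀ {t c} → 0ℚ ℚ.< c → 0ℚ ℚ.< t ℚ.* c → 0ℚ ℚ.< t
    pos-factor {t} {c} 0<c 0<tc = ℚP.*-cancelʳ-<-nonNeg c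
      ⦃ ℚ.nonNegative (ℚP.<⇒≤ 0<c) ⦄
      (subst (ℚ._< t ℚ.* c) (sym (ℚP.*-zeroˡ c)) 0<tc)

    small : ∀ {c K} → 0ℚ ℚ.≤ c → 0ℚ ℚ.< K →
            ∃ λ ε → 0ℚ ℚ.< ε × c ℚ.* ε ℚ.< K
    small {c} {K} 0≤c 0<K = ε , 0<ε , undiff 0<ε (trans (eq1 c ε) ε*[1+c]≡K)
      where
      0<1+c : 0ℚ ℚ.< 1ℚ ℚ.+ c
      0<1+c = ℚP.<-≤-trans 0<1 (undiff≤ 0≤c refl)
      ε : ℚ
      ε = proj₁ (quotient K 0<1+c)
      ε*[1+c]≡K : ε ℚ.* (1ℚ ℚ.+ c) ≡ K
      ε*[1+c]≡K = proj₂ (quotient K 0<1+c)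
      0<ε : 0ℚ ℚ.< ε
      0<ε = pos-factor 0<1+c (subst (0ℚ ℚ.<_) (sym ε*[1+c]≡K) 0<K)

    raise : ∀ {p a c} → 0ℚ ℚ.< c → p ℚ.* c ℚ.< a →
            ∃ λ q → p ℚ.< q × q ℚ.* c ℚ.< a
    raise {p} {a} {c} 0<c pc<a =
      let ε , 0<ε , cε<K = small (ℚP.<⇒≤ 0<c) (diff pc<a)
      in p ℚ.+ ε , undiff 0<ε refl , undiff (diff cε<K) (eq2 p c a ε)

    lower : ∀ {p a c} → 0ℚ ℚ.< c → a ℚ.< p ℚ.* c →
            ∃ λ q → q ℚ.< p × a ℚ.< q ℚ.* c
    lower {p} {a} {c} 0<c a<pc =
      let ε , 0<ε , cε<K = small (ℚP.<⇒≤ 0<c) (diff a<pc)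
      in p ℚ.- ε , undiff 0<ε (eq3 p ε) , undiff (diff cε<K) (eq4 p c a ε)

    *c-mono : ∀ {p q c} → 0ℚ ℚ.< c → p ℚ.< q → p ℚ.* c ℚ.< q ℚ.* c
    *c-mono {c = c} 0<c = ℚP.*-monoˡ-<-pos c ⦃ ℚ.positive 0<c ⦄

    *c-mono≤ : ∀ {p q c} → 0ℚ ℚ.< c → p ℚ.≤ q → p ℚ.* c ℚ.≤ q ℚ.* c
    *c-mono≤ {c = c} 0<c = ℚP.*-monoʳ-≤-nonNeg c ⦃ ℚ.nonNegative (ℚP.<⇒≤ 0<c) ⦄

    multiple : ℕ → ℚ → ℚ
    multiple zero    δ = 0ℚ
    multiple (suc n) δ = δ ℚ.+ multiple n δ

    suc/1 : ∀ n → + suc n ℚ./ 1 ≡ 1ℚ ℚ.+ + n ℚ./ 1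
    suc/1 n = _-Raw-AlmostCommutative⟶_.+-homo ℤ⟶ℚ (+ 1) (+ n)

    multiple-* : ∀ n δ → multiple n δ ≡ (+ n ℚ./ 1) ℚ.* δ
    multiple-* zero    δ = sym (ℚP.*-zeroˡ δ)
    multiple-* (suc n) δ = trans (cong (δ ℚ.+_) (multiple-* n δ))
      (trans (eq5 δ (+ n ℚ./ 1))
        (cong (ℚ._* δ) (sym (suc/1 n))))

    ≤-numerator : ∀ t → ∃ λ n → t ℚ.≤ + n ℚ./ 1
    ≤-numerator t@(mkℚ num d _) = ℤ.∣ num ∣ , ℚP.toℚᵘ-cancel-≤
      (ℚᵘP.≤-respʳ-≃ (ℚᵘP.≃-sym (/1-homo (+ ℤ.∣ num ∣)))
        (ℚᵘ.*≤* (bound num)))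
      where
      bound : ∀ z → z ℤ.* + 1 ℤ.≤ + ℤ.∣ z ∣ ℤ.* + suc d
      bound (+ m)      = subst₂ ℤ._≤_ (ℤP.pos-* m 1) (ℤP.pos-* m (suc d))
                           (+≤+ (ℕP.*-monoʳ-≤ m (ℕ.s≤s ℕ.z≤n)))
      bound ℤ.-[1+ m ] = ℤ.-≤+

    archimedean : ∀ D {δ} → 0ℚ ℚ.< δ → ∃ λ n → D ℚ.≤ multiple n δ
    archimedean D {δ} 0<δ with quotient D 0<δ
    ... | t , refl with ≤-numerator t
    ...   | n , t≤n = n , subst (t ℚ.* δ ℚ.≤_) (sym (multiple-* n δ))
                            (*c-mono≤ 0<δ t≤n)

    lower<upper : ∀ x {a b} → Lower x a → Upper x b → a ℚ.< b
    lower<upper x {a} {b} la ub with ℚP.<-cmp a b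
    ... | tri< a<b _ _ = a<b
    ... | tri≈ _ refl _ = ⊥-elim (disjoint x la ub)
    ... | tri> _ _ b<a = ⊥-elim (disjoint x la (upper-closed x b<a ub))

    approximate : ∀ x {a₀ ε} → Lower x a₀ → 0ℚ ℚ.< ε →
      ∃ λ a → ∃ λ b → a₀ ℚ.≤ a × Lower x a × Upper x b × b ℚ.≤ a ℚ.+ ε
    approximate x {a₀} {ε} la₀ 0<ε with ℚP.<-dense 0<ε
    ... | δ , 0<δ , δ<ε =
      let b₀ , ub₀ = upper-inhabited x
          n , gap  = archimedean (b₀ ℚ.- a₀) 0<δ
      in go n ℚP.≤-refl la₀ ub₀ gap
      where
      go : ∀ n {a b} → a₀ ℚ.≤ a → Lower x a → Upper x b →
           b ℚ.- a ℚ.≤ multiple n δ →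
           ∃ λ a → ∃ λ b → a₀ ℚ.≤ a × Lower x a × Upper x b × b ℚ.≤ a ℚ.+ ε
      go zero a₀≤a la ub gap = ⊥-elim
        (ℚP.<-irrefl refl (ℚP.<-≤-trans (diff (lower<upper x la ub)) gap))
      go (suc n) {a} {b} a₀≤a la ub gap with located x (ℚP.+-monoʳ-< a δ<ε)
      ... | inj₂ u = a , a ℚ.+ ε , a₀≤a , la , u , ℚP.≤-refl
      ... | inj₁ l = go n
        (ℚP.≤-trans a₀≤a (undiff≤ (ℚP.<⇒≤ 0<δ) refl)) l ub
        (undiff≤ (diff≤ gap)
          (eq6 b a δ (multiple n δ)))

open Lemmas

infix 4 _<_ _≤_

_<_ : ℝ → ℝ → Set
x < y = ∃ λ q → Upper x q × Lower y q

_≤_ : ℝ → ℝ → Set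
x ≤ y = ∀ q → Lower x q → Lower y q

fromℚ : ℚ → ℝ
fromℚ r = record
  { Lower           = ℚ._< r
  ; Upper           = r ℚ.<_
  ; lower-inhabited = r ℚ.- 1ℚ , undiff 0<1 (eq7 r)
  ; upper-inhabited = r ℚ.+ 1ℚ , undiff 0<1 refl
  ; lower-closed    = ℚP.<-trans
  ; upper-closed    = λ p<q r<p → ℚP.<-trans r<p p<q
  ; lower-open      = λ p<r → let m , p<m , m<r = ℚP.<-dense p<r in m , p<m , m<r
  ; upper-open      = λ r<q → let m , r<m , m<q = ℚP.<-dense r<q in m , m<q , r<m
  ; disjoint        = λ p<r r<p → ℚP.<-irrefl refl (ℚP.<-trans p<r r<p)
  ; located         = loc
  }
  where
  loc : ∀ {p q} → p ℚ.< q → p ℚ.< r ⊎ r ℚ.< q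
  loc {p} {q} p<q with p ℚP.<? r
  ... | yes p<r = inj₁ p<r
  ... | no  p≮r = inj₂ (ℚP.≤-<-trans (ℚP.≮⇒≥ p≮r) p<q)

fromℕ : ℕ → ℝ
fromℕ n = fromℚ (+ n ℚ./ 1)

0ℝ 1ℝ : ℝ
0ℝ = fromℚ 0ℚ
1ℝ = fromℚ 1ℚ

infix  8 -_
infixl 6 _+_ _-_

_+_ : ℝ → ℝ → ℝ
x + y = record
  { Lower           = L
  ; Upper           = U
  ; lower-inhabited =
      let a , la = lower-inhabited x
          b , lb = lower-inhabited y
      in a ℚ.+ b ℚ.- 1ℚ , a , b , la , lb , undiff 0<1 (eq7 (a ℚ.+ b))
  ; upper-inhabited =
      let a , ua = upper-inhabited x
          b , ub = upper-inhabited y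
      in a ℚ.+ b ℚ.+ 1ℚ , a , b , ua , ub , undiff 0<1 refl
  ; lower-closed    = λ p<q (a , b , la , lb , q<) → a , b , la , lb , ℚP.<-trans p<q q<
  ; upper-closed    = λ p<q (a , b , ua , ub , <p) → a , b , ua , ub , ℚP.<-trans <p p<q
  ; lower-open      = λ (a , b , la , lb , p<) →
      let m , p<m , m< = ℚP.<-dense p< in m , p<m , a , b , la , lb , m<
  ; upper-open      = λ (a , b , ua , ub , <q) →
      let m , <m , m<q = ℚP.<-dense <q in m , m<q , a , b , ua , ub , <m
  ; disjoint        = λ (a , b , la , lb , p<) (c , d , uc , ud , <p) →
      ℚP.<-asym (ℚP.<-trans <p p<)
        (ℚP.+-mono-< (lower<upper x la uc) (lower<upper y lb ud))
  ; located         = loc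
  }
  where
  L U : ℚ → Set
  L p = ∃ λ a → ∃ λ b → Lower x a × Lower y b × p ℚ.< a ℚ.+ b
  U p = ∃ λ a → ∃ λ b → Upper x a × Upper y b × a ℚ.+ b ℚ.< p

  loc : ∀ {p q} → p ℚ.< q → L p ⊎ U q
  loc {p} {q} p<q =
    let ε , 0<ε , 2ε<q-p = small (ℚP.+-mono-≤ 0≤1 0≤1) (diff p<q)
        a , b , _ , la , ub , b≤ = approximate x (proj₂ (lower-inhabited x)) 0<ε
        c , d , _ , lc , ud , d≤ = approximate y (proj₂ (lower-inhabited y)) 0<ε
    in case p ℚP.<? (a ℚ.+ c) of λ
      { (yes p<a+c) → inj₁ (a , c , la , lc , p<a+c)
      ; (no  p≮a+c) → inj₂ (b , d , ub , ud , ℚP.≤-<-trans (ℚP.+-mono-≤ b≤ d≤)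
          (undiff (ℚP.+-mono-<-≤ (diff 2ε<q-p) (diff≤ (ℚP.≮⇒≥ p≮a+c))) (eq8 a c ε p q)))
      }

-_ : ℝ → ℝ
- x = record
  { Lower           = λ p → Upper x (ℚ.- p)
  ; Upper           = λ p → Lower x (ℚ.- p)
  ; lower-inhabited = let b , ub = upper-inhabited x in
                      ℚ.- b , subst (Upper x) (eq9 b) ub
  ; upper-inhabited = let a , la = lower-inhabited x in
                      ℚ.- a , subst (Lower x) (eq9 a) la
  ; lower-closed    = λ p<q → upper-closed x (ℚP.neg-antimono-< p<q)
  ; upper-closed    = λ p<q → lower-closed x (ℚP.neg-antimono-< p<q)
  ; lower-open      = λ {p} u → let q , q< , uq = upper-open x u in
                      ℚ.- q , subst (ℚ._< ℚ.- q) (sym (eq9 p)) (ℚP.neg-antimono-< q<)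
                      , subst (Upper x) (eq9 q) uq
  ; upper-open      = λ {p} l → let q , <q , lq = lower-open x l in
                      ℚ.- q , subst (ℚ.- q ℚ.<_) (sym (eq9 p)) (ℚP.neg-antimono-< <q)
                      , subst (Lower x) (eq9 q) lq
  ; disjoint        = λ u l → disjoint x l u
  ; located         = λ p<q → swap (located x (ℚP.neg-antimono-< p<q))
  }

_-_ : ℝ → ℝ → ℝ
x - y = x + (- y)

-- x / y [ 0<y ] is the quotient for positive y.  Since y lies between c and d,
-- p * y < x follows from p * c < a and p * d < a for some a < x, whatever the
-- sign of p.

infixl 7 _/_[_]

_/_[_] : (x y : ℝ) → 0ℝ < y → ℝ
x / y [ c₀ , 0<c₀ , lc₀ ] = record
  { Lower           = L
  ; Upper           = U
  ; lower-inhabited = linh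
  ; upper-inhabited = uinh
  ; lower-closed    = λ p<q (a , c , d , la , 0<c , lc , ud , qc< , qd<) →
      a , c , d , la , 0<c , lc , ud
      , ℚP.<-trans (*c-mono 0<c p<q) qc<
      , ℚP.<-trans (*c-mono (ℚP.<-trans 0<c (lower<upper y lc ud)) p<q) qd<
  ; upper-closed    = λ p<q (a , c , d , ua , 0<c , lc , ud , <pc , <pd) →
      a , c , d , ua , 0<c , lc , ud
      , ℚP.<-trans <pc (*c-mono 0<c p<q)
      , ℚP.<-trans <pd (*c-mono (ℚP.<-trans 0<c (lower<upper y lc ud)) p<q)
  ; lower-open      = lopen
  ; upper-open      = uopen
  ; disjoint        = λ {p} → disj {p}
  ; located         = loc
  }
  where
  L U : ℚ → Set
  L p = ∃ λ a → ∃ λ c → ∃ λ d → Lower x a × 0ℚ ℚ.< c × Lower y c × Upper y d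
          × p ℚ.* c ℚ.< a × p ℚ.* d ℚ.< a
  U p = ∃ λ a → ∃ λ c → ∃ λ d → Upper x a × 0ℚ ℚ.< c × Lower y c × Upper y d
          × a ℚ.< p ℚ.* c × a ℚ.< p ℚ.* d

  d₀ : ℚ
  d₀ = proj₁ (upper-inhabited y)

  ud₀ : Upper y d₀
  ud₀ = proj₂ (upper-inhabited y)

  c₀≤d₀ : c₀ ℚ.≤ d₀
  c₀≤d₀ = ℚP.<⇒≤ (lower<upper y lc₀ ud₀)

  big : ∀ a → ∃ λ t → ℚ.∣ a ∣ ℚ.< t ℚ.* c₀ × ℚ.∣ a ∣ ℚ.< t ℚ.* d₀
  big a with quotient (ℚ.∣ a ∣ ℚ.+ 1ℚ) 0<c₀
  ... | t , eq = t , h , ℚP.<-≤-trans h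
    (ℚP.*-monoˡ-≤-nonNeg t ⦃ ℚ.nonNegative (ℚP.<⇒≤ 0<t) ⦄ c₀≤d₀)
    where
    h : ℚ.∣ a ∣ ℚ.< t ℚ.* c₀
    h = undiff 0<1 (sym eq)
    0<t : 0ℚ ℚ.< t
    0<t = pos-factor 0<c₀ (ℚP.≤-<-trans 0≤∣ a ∣ h)

  linh : ∃ L
  linh with lower-inhabited x
  ... | a , la with big a
  ...   | t , h₁ , h₂ = ℚ.- t , a , c₀ , d₀ , la , 0<c₀ , lc₀ , ud₀ , flip h₁ , flip h₂
    where
    flip : ∀ {c} → ℚ.∣ a ∣ ℚ.< t ℚ.* c → ℚ.- t ℚ.* c ℚ.< a
    flip {c} h = undiff (diff (ℚP.≤-<-trans (-p≤∣p∣ a) h))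
      (eq10 t c a)

  uinh : ∃ U
  uinh with upper-inhabited x
  ... | a , ua with big a
  ...   | t , h₁ , h₂ = t , a , c₀ , d₀ , ua , 0<c₀ , lc₀ , ud₀
          , ℚP.≤-<-trans (p≤∣p∣ a) h₁ , ℚP.≤-<-trans (p≤∣p∣ a) h₂

  lopen : ∀ {p} → L p → ∃ λ q → p ℚ.< q × L q
  lopen (a , c , d , la , 0<c , lc , ud , pc< , pd<)
    with ℚP.<-trans 0<c (lower<upper y lc ud)
  ... | 0<d with raise 0<c pc< | raise 0<d pd<
  ...   | q , p<q , qc< | r , p<r , rd< with ℚP.≤-total q r
  ...     | inj₁ q≤r = q , p<q , a , c , d , la , 0<c , lc , ud
                       , qc< , ℚP.≤-<-trans (*c-mono≤ 0<d q≤r) rd<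
  ...     | inj₂ r≤q = r , p<r , a , c , d , la , 0<c , lc , ud
                       , ℚP.≤-<-trans (*c-mono≤ 0<c r≤q) qc< , rd<

  uopen : ∀ {p} → U p → ∃ λ q → q ℚ.< p × U q
  uopen (a , c , d , ua , 0<c , lc , ud , <pc , <pd)
    with ℚP.<-trans 0<c (lower<upper y lc ud)
  ... | 0<d with lower 0<c <pc | lower 0<d <pd
  ...   | q , q<p , <qc | r , r<p , <rd with ℚP.≤-total q r
  ...     | inj₁ q≤r = r , r<p , a , c , d , ua , 0<c , lc , ud
                       , ℚP.<-≤-trans <qc (*c-mono≤ 0<c q≤r) , <rd
  ...     | inj₂ r≤q = q , q<p , a , c , d , ua , 0<c , lc , ud
                       , <qc , ℚP.<-≤-trans <rd (*c-mono≤ 0<d r≤q)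

  disj : ∀ {p} → L p → U p → ⊥
  disj {p} (a , c , d , la , 0<c , lc , ud , pc<a , pd<a)
           (a′ , c′ , d′ , ua′ , 0<c′ , lc′ , ud′ , a′<pc′ , a′<pd′)
    with ℚP.≤-total 0ℚ p
  ... | inj₁ 0≤p = ℚP.<-irrefl refl
    (ℚP.<-≤-trans (ℚP.<-trans pd<a (ℚP.<-trans (lower<upper x la ua′) a′<pc′))
      (ℚP.*-monoˡ-≤-nonNeg p ⦃ ℚ.nonNegative 0≤p ⦄ (ℚP.<⇒≤ (lower<upper y lc′ ud))))
  ... | inj₂ p≤0 = ℚP.<-irrefl refl
    (ℚP.<-≤-trans (ℚP.<-trans pc<a (ℚP.<-trans (lower<upper x la ua′) a′<pd′))
      (ℚP.*-monoˡ-≤-nonPos p ⦃ ℚ.nonPositive p≤0 ⦄ (ℚP.<⇒≤ (lower<upper y lc ud′))))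

  module Located {p q} (p<q : p ℚ.< q) {c d ε} (0<ε : 0ℚ ℚ.< ε)
    (sε<K : (ℚ.∣ p ∣ ℚ.+ ℚ.∣ q ∣) ℚ.* ε ℚ.< (q ℚ.- p) ℚ.* c₀)
    (c₀≤c : c₀ ℚ.≤ c) (lc : Lower y c) (ud : Upper y d) (d≤c+ε : d ℚ.≤ c ℚ.+ ε)
    where
    0<c : 0ℚ ℚ.< c
    0<c = ℚP.<-≤-trans 0<c₀ c₀≤c
    c<d : c ℚ.< d
    c<d = lower<upper y lc ud
    0<d : 0ℚ ℚ.< d
    0<d = ℚP.<-trans 0<c c<d

    s : ℚ
    s = ℚ.∣ p ∣ ℚ.+ ℚ.∣ q ∣

    pc+sε<qc : p ℚ.* c ℚ.+ s ℚ.* ε ℚ.< q ℚ.* c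
    pc+sε<qc = subst (p ℚ.* c ℚ.+ s ℚ.* ε ℚ.<_) (eq11 p q c)
      (ℚP.+-monoʳ-< (p ℚ.* c) (ℚP.<-≤-trans sε<K
        (ℚP.*-monoˡ-≤-nonNeg (q ℚ.- p) ⦃ ℚ.nonNegative (ℚP.<⇒≤ (diff p<q)) ⦄ c₀≤c)))

    spread : ∀ {r R t} → r ℚ.≤ R → 0ℚ ℚ.≤ R → 0ℚ ℚ.≤ t →
             r ℚ.* d ℚ.≤ r ℚ.* c ℚ.+ (R ℚ.+ t) ℚ.* ε
    spread {r} {R} {t} r≤R 0≤R 0≤t = ℚP.≤-trans
      (undiff≤ (nonNeg* (diff≤ r≤R) (ℚP.<⇒≤ (diff c<d))) (eq12 r R c d))
      (ℚP.+-monoʳ-≤ (r ℚ.* c) (ℚP.≤-trans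
        (ℚP.*-monoˡ-≤-nonNeg R ⦃ ℚ.nonNegative 0≤R ⦄ d-c≤ε)
        (ℚP.*-monoʳ-≤-nonNeg ε ⦃ ℚ.nonNegative (ℚP.<⇒≤ 0<ε) ⦄ (undiff≤ {R} 0≤t refl))))
      where
      d-c≤ε : d ℚ.- c ℚ.≤ ε
      d-c≤ε = undiff≤ (diff≤ d≤c+ε) (eq13 c d ε)

    pd<qc : p ℚ.* d ℚ.< q ℚ.* c
    pd<qc = ℚP.≤-<-trans (spread (p≤∣p∣ p) 0≤∣ p ∣ 0≤∣ q ∣) pc+sε<qc

    qc≤qd+sε : q ℚ.* c ℚ.≤ q ℚ.* d ℚ.+ s ℚ.* ε
    qc≤qd+sε = undiff≤ (diff≤ (spread (-p≤∣p∣ q) 0≤∣ q ∣ 0≤∣ p ∣))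
      (eq14 q c d ℚ.∣ p ∣ ℚ.∣ q ∣ ε)

    pc<qd : p ℚ.* c ℚ.< q ℚ.* d
    pc<qd = undiff (diff (ℚP.<-≤-trans pc+sε<qc qc≤qd+sε))
      (eq15 (p ℚ.* c) (q ℚ.* d) (s ℚ.* ε))

    try : ∀ {m n} → p ℚ.* c ℚ.≤ m → p ℚ.* d ℚ.≤ m →
          n ℚ.≤ q ℚ.* c → n ℚ.≤ q ℚ.* d → m ℚ.< n → L p ⊎ U q
    try pc≤ pd≤ ≤qc ≤qd m<n with ℚP.<-dense m<n
    ... | i , m<i , i<n with ℚP.<-dense i<n
    ...   | j , i<j , j<n with located x i<j
    ...     | inj₁ li = inj₁ (i , c , d , li , 0<c , lc , ud
                              , ℚP.≤-<-trans pc≤ m<i , ℚP.≤-<-trans pd≤ m<i)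
    ...     | inj₂ uj = inj₂ (j , c , d , uj , 0<c , lc , ud
                              , ℚP.<-≤-trans j<n ≤qc , ℚP.<-≤-trans j<n ≤qd)

    split : L p ⊎ U q
    split with ℚP.≤-total (p ℚ.* c) (p ℚ.* d) | ℚP.≤-total (q ℚ.* c) (q ℚ.* d)
    ... | inj₁ h | inj₁ k = try h ℚP.≤-refl ℚP.≤-refl k pd<qc
    ... | inj₁ h | inj₂ k = try h ℚP.≤-refl k ℚP.≤-refl (*c-mono 0<d p<q)
    ... | inj₂ h | inj₁ k = try ℚP.≤-refl h ℚP.≤-refl k (*c-mono 0<c p<q)
    ... | inj₂ h | inj₂ k = try ℚP.≤-refl h k ℚP.≤-refl pc<qd

  loc : ∀ {p q} → p ℚ.< q → L p ⊎ U q
  loc {p} {q} p<q =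
    let ε , 0<ε , sε<K = small (ℚP.+-mono-≤ 0≤∣ p ∣ 0≤∣ q ∣) (pos* (diff p<q) 0<c₀)
        c , d , c₀≤c , lc , ud , d≤c+ε = approximate y lc₀ 0<ε
    in Located.split p<q 0<ε sε<K c₀≤c lc ud d≤c+ε

-- √ is totalised by √ x = 0 for x < 0.

infix 9 √_

√_ : ℝ → ℝ
√ x = record
  { Lower           = L
  ; Upper           = U
  ; lower-inhabited = ℚ.- 1ℚ , inj₁ (ℚP.negative⁻¹ (ℚ.- 1ℚ))
  ; upper-inhabited = uinh
  ; lower-closed    = lclosed
  ; upper-closed    = λ p<q (0<p , u) →
      ℚP.<-trans 0<p p<q , upper-closed x (square-< (ℚP.<⇒≤ 0<p) p<q) u
  ; lower-open      = lopen
  ; upper-open      = uopen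
  ; disjoint        = λ { (inj₁ p<0) (0<p , _) → ℚP.<-asym p<0 0<p
                        ; (inj₂ l)   (_   , u) → disjoint x l u }
  ; located         = loc
  }
  where
  L U : ℚ → Set
  L p = p ℚ.< 0ℚ ⊎ Lower x (p ℚ.* p)
  U p = 0ℚ ℚ.< p × Upper x (p ℚ.* p)

  square-< : ∀ {p q} → 0ℚ ℚ.≤ p → p ℚ.< q → p ℚ.* p ℚ.< q ℚ.* q
  square-< {p} {q} 0≤p p<q = undiff
    (ℚP.+-mono-<-≤ (pos* (diff p<q) (ℚP.≤-<-trans 0≤p p<q))
                   (nonNeg* 0≤p (ℚP.<⇒≤ (diff p<q))))
    (eq16 p q)

  uinh : ∃ U
  uinh with upper-inhabited x
  ... | b , ub = t , 0<t , upper-closed x (undiff 0<e eq) ub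
    where
    t e : ℚ
    t = 1ℚ ℚ.+ ℚ.∣ b ∣
    e = 1ℚ ℚ.+ ((ℚ.∣ b ∣ ℚ.- b) ℚ.+ (ℚ.∣ b ∣ ℚ.+ ℚ.∣ b ∣ ℚ.* ℚ.∣ b ∣))
    0<t : 0ℚ ℚ.< t
    0<t = ℚP.+-mono-<-≤ 0<1 0≤∣ b ∣
    0<e : 0ℚ ℚ.< e
    0<e = ℚP.+-mono-<-≤ 0<1 (ℚP.+-mono-≤ (diff≤ (p≤∣p∣ b))
            (ℚP.+-mono-≤ 0≤∣ b ∣ (nonNeg* 0≤∣ b ∣ 0≤∣ b ∣)))
    eq : b ℚ.+ e ≡ t ℚ.* t
    eq = eq17 b ℚ.∣ b ∣

  lclosed : ∀ {p q} → p ℚ.< q → L q → L p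
  lclosed p<q (inj₁ q<0) = inj₁ (ℚP.<-trans p<q q<0)
  lclosed {p} p<q (inj₂ l) with p ℚP.<? 0ℚ
  ... | yes p<0 = inj₁ p<0
  ... | no  p≮0 = inj₂ (lower-closed x (square-< (ℚP.≮⇒≥ p≮0) p<q) l)

  lopen : ∀ {p} → L p → ∃ λ q → p ℚ.< q × L q
  lopen (inj₁ p<0) = let m , p<m , m<0 = ℚP.<-dense p<0 in m , p<m , inj₁ m<0
  lopen {p} (inj₂ l) with p ℚP.<? 0ℚ
  ... | yes p<0 = let m , p<m , m<0 = ℚP.<-dense p<0 in m , p<m , inj₁ m<0
  ... | no  p≮0 =
    let s , pp<s , ls = lower-open x l
        ε , 0<ε , h   = small 0≤2p+1 (diff pp<s)
    in case ℚP.≤-total ε 1ℚ of λ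
      { (inj₁ ε≤1) → p ℚ.+ ε , undiff 0<ε refl , inj₂ (lower-closed x
          (undiff (ℚP.+-mono-<-≤ (diff h) (nonNeg* (ℚP.<⇒≤ 0<ε) (diff≤ ε≤1)))
            (eq18 p ε s)) ls)
      ; (inj₂ 1≤ε) → p ℚ.+ 1ℚ , undiff 0<1 refl , inj₂ (lower-closed x
          (undiff (ℚP.+-mono-<-≤ (diff h) (nonNeg* 0≤2p+1 (diff≤ 1≤ε)))
            (eq19 p ε s)) ls)
      }
    where
    0≤2p+1 : 0ℚ ℚ.≤ p ℚ.+ p ℚ.+ 1ℚ
    0≤2p+1 = ℚP.+-mono-≤ (ℚP.+-mono-≤ (ℚP.≮⇒≥ p≮0) (ℚP.≮⇒≥ p≮0)) 0≤1

  uopen : ∀ {q} → U q → ∃ λ p → p ℚ.< q × U p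
  uopen {q} (0<q , u) =
    let s , s<qq , us = upper-open x u
        ε , 0<ε , h   = small 0≤2q (diff s<qq)
        p , 0<p , p<q = ℚP.<-dense 0<q
    in case ε ℚP.<? q of λ
      { (yes ε<q) → q ℚ.- ε , undiff 0<ε (eq3 q ε) , diff ε<q , upper-closed x
          (undiff (ℚP.+-mono-<-≤ (diff h) (nonNeg* (ℚP.<⇒≤ 0<ε) (ℚP.<⇒≤ 0<ε)))
            (eq20 q ε s)) us
      ; (no  ε≮q) → p , p<q , 0<p , upper-closed x
          (undiff (ℚP.+-mono-<-≤ (diff h) (ℚP.+-mono-≤ (nonNeg* 0≤2q (diff≤ (ℚP.≮⇒≥ ε≮q)))
              (ℚP.+-mono-≤ (nonNeg* (ℚP.<⇒≤ 0<q) (ℚP.<⇒≤ 0<q))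
                           (nonNeg* (ℚP.<⇒≤ 0<p) (ℚP.<⇒≤ 0<p)))))
            (eq21 q ε s p)) us
      }
    where
    0≤2q : 0ℚ ℚ.≤ q ℚ.+ q
    0≤2q = ℚP.+-mono-≤ (ℚP.<⇒≤ 0<q) (ℚP.<⇒≤ 0<q)

  loc : ∀ {p q} → p ℚ.< q → L p ⊎ U q
  loc {p} p<q with p ℚP.<? 0ℚ
  ... | yes p<0 = inj₁ (inj₁ p<0)
  ... | no  p≮0 = case located x (square-< (ℚP.≮⇒≥ p≮0) p<q) of λ
    { (inj₁ l) → inj₁ (inj₂ l)
    ; (inj₂ u) → inj₂ (ℚP.≤-<-trans (ℚP.≮⇒≥ p≮0) p<q , u)
    }

1≤x⇒0<x : ∀ x → 1ℝ ≤ x → 0ℝ < x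
1≤x⇒0<x x 1≤x = let m , 0<m , m<1 = ℚP.<-dense 0<1 in m , 0<m , 1≤x m m<1

1<x⇒0<√x-1 : ∀ x → 1ℝ < x → 0ℝ < √ x - 1ℝ
1<x⇒0<√x-1 x (q , 1<q , lq) =
  let a , 1<a , la  = lower-open (√ x) {1ℚ} (inj₂ (lower-closed x 1<q lq))
      b , 1<b , b<a = ℚP.<-dense 1<a
      m , 0<m , m<  = ℚP.<-dense (diff b<a)
  in m , 0<m , a , ℚ.- b , la , subst (1ℚ ℚ.<_) (eq9 b) 1<b , m<

IsFloor : ℝ → ℕ → Set
IsFloor x M = fromℕ M ≤ x × x < fromℕ (suc M)

-- A subset of {1, …, M} is a Subset M in which the index i stands for 1 + toℕ i.
value : ∀ {M} → Fin M → ℕ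
value i = suc (toℕ i)

module ℕΣ where
  open import Algebra.Properties.CommutativeMonoid.Sum ℕP.+-0-commutativeMonoid public
    using (sum)

module ℚΣ where
  open import Algebra.Properties.CommutativeMonoid.Sum ℚP.+-0-commutativeMonoid public
    using (sum)

∑1/ : ∀ {M} → Subset M → ℚ
∑1/ A = ℚΣ.sum λ i → if lookup A i then + 1 ℚ./ value i else 0ℚ

{-# OPTIONS --safe #-}
module Submission where

-- The proof discretises Bleichenbacher's theorem on open additive semigroups.
-- Call finitely many disjoint intervals (α_j , β_j) bad for T if no sum of
-- intervals, taken with repetition, has T in its interior.  Put
-- h_j = β_j − β_{j−1} and d_j = α_j h_j − T (β_j − α_j), and move the left ends
-- along α + t d.  The family stays bad: if the right ends of a sum n add up to
-- more than T, but no longer do so when any one index of n is lowered by one,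
-- then n·(β − α) ≤ h_j for every j in n, so n·d ≥ (n·(β − α)) (n·α − T) ≥ 0.
-- If ∑ d_j / α_j < 0, then ∏ α_j decreases by AM–GM; stopping when an interval
-- becomes empty or touches its predecessor leaves a bad family with fewer
-- intervals.  If ∑ d_j / α_j ≥ 0, then ∑ (β_j − α_j) / α_j ≤ (∑ h_j) / T.
-- So in the end ∏ β_j / α_j ≤ ∏ (1 + x_j) with ∑ x_j ≤ (max β) / T.
--
-- If no sum of elements of A works, the intervals (a , a + 1) with a ∈ A are bad
-- for N, and AM–GM turns the bound into ∑ 1/(a+1) ≤ (m+1)/N with m = max A.
-- Moreover a + 1 ≥ √N for all a ∈ A, since otherwise a multiple of a works, so
-- ∑ (1/a − 1/(a+1)) ≤ 1/(√N − 1) − 1/(m+1), contradicting the hypothesis.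

open import Algebra.Bundles using (CommutativeMonoid; CommutativeRing)
import Algebra.Properties.CommutativeSemigroup as CommutativeSemigroupProperties
import Algebra.Solver.Ring as RingSolver
open import Algebra.Solver.Ring.AlmostCommutativeRing
  using (_-Raw-AlmostCommutative⟶_; fromCommutativeRing)
open import Data.Bool.Base using (true; false; if_then_else_)
open import Data.Empty using (⊥; ⊥-elim)
open import Data.Fin.Base using (Fin; zero; suc; toℕ; punchIn; inject₁)
import Data.Fin.Permutation as Perm
import Data.Fin.Permutation.Components as PC
import Data.Fin.Properties as FinP
open import Data.Fin.Subset using (Subset; _∈_)
import Data.Integer.Base as ℤ
import Data.Integer.Properties as ℤP
open import Data.List.Base
  using (List; []; _∷_; _++_; foldr; map; replicate; tabulate; length; lookup)
open import Data.List.Membership.Propositional using (find)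
open import Data.List.Membership.Propositional.Properties using (∈-∃++)
open import Data.List.Relation.Unary.All as All using (All; []; _∷_)
import Data.List.Relation.Unary.All.Properties as AllP
import Data.List.Relation.Unary.Any as Any
open import Data.Nat.Base as ℕ using (ℕ; zero; suc)
import Data.Nat.Properties as ℕP
open import Data.Product using (∃; _×_; _,_; proj₁; proj₂)
open import Data.Rational.Base as ℚ using (ℚ; 0ℚ; 1ℚ)
import Data.Rational.Properties as ℚP
import Data.Rational.Unnormalised.Base as ℚᵘ
import Data.Rational.Unnormalised.Properties as ℚᵘP
open import Data.Sum.Base using (_⊎_; inj₁; inj₂)
import Data.Vec.Base as Vec
open import Defs using (module Lemmas)
open import Function.Base using (_∘_; case_of_)
open import Relation.Binary.Definitions using (tri<; tri≈; tri>)
open import Relation.Binary.PropositionalEquality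
open import Relation.Nullary using (¬_; Dec; yes; no; _×-dec_; _⊎-dec_)

open CommutativeSemigroupProperties
  (CommutativeMonoid.commutativeSemigroup ℚP.+-0-commutativeMonoid) using ()
  renaming (x∙yz≈y∙xz to +-swap; x∙yz≈yx∙z to +-shift; interchange to +-interchange)
open CommutativeSemigroupProperties
  (CommutativeMonoid.commutativeSemigroup ℚP.*-1-commutativeMonoid) using ()
  renaming (x∙yz≈y∙xz to *-swap; x∙yz≈yx∙z to *-shift; interchange to *-interchange)
open CommutativeSemigroupProperties ℕP.+-commutativeSemigroup using ()
  renaming (x∙yz≈y∙xz to ℕ-swap)

-- Polynomial identities in commutative rings.

-- As in Defs, the identities are proved in an arbitrary ring because the solver
-- is too slow on ℚ itself.
module RingIdentities {c ℓ} (R : CommutativeRing c ℓ)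
  (φ : ℤ.+-*-rawRing -Raw-AlmostCommutative⟶ fromCommutativeRing R) where
  open CommutativeRing R using (_≈_; _+_; _*_; _-_; -_) renaming (refl to ≈-refl)
  open Lemmas.Identities R φ using (coeff≟) renaming (one to 1#)
  open _-Raw-AlmostCommutative⟶_ φ using (⟦_⟧)
  open RingSolver ℤ.+-*-rawRing (fromCommutativeRing R) φ coeff≟
    using (Polynomial; solve; _:=_; _:+_; _:*_; _:-_; :-_; con)

  0# = ⟦ ℤ.+ 0 ⟧

  𝟘 𝟙 : ∀ {n} → Polynomial n
  𝟘 = con (ℤ.+ 0)
  𝟙 = con (ℤ.+ 1)

  product-excess : ∀ e f → - 1# + (1# + e) * (1# + f) ≈ e + f + e * f
  product-excess = solve 2 (λ e f → :- 𝟙 :+ (𝟙 :+ e) :* (𝟙 :+ f) := e :+ f :+ e :* f) ≈-refl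

  product-excess-* : ∀ e f p → (1# + (e + f + e * f)) * p ≈ (1# + e) * ((1# + f) * p)
  product-excess-* = solve 3 (λ e f p →
    (𝟙 :+ (e :+ f :+ e :* f)) :* p := (𝟙 :+ e) :* ((𝟙 :+ f) :* p)) ≈-refl

  excess-sumʳ : ∀ e f s t → e + f + e * f + (s + t) + e * (- f) ≈ e + (s + (f + t))
  excess-sumʳ = solve 4 (λ e f s t →
    e :+ f :+ e :* f :+ (s :+ t) :+ e :* (:- f) := e :+ (s :+ (f :+ t))) ≈-refl

  excess-sumˡ : ∀ e f s t → e + f + e * f + (s + t) + (- e) * f ≈ e + ((f + s) + t)
  excess-sumˡ = solve 4 (λ e f s t →
    e :+ f :+ e :* f :+ (s :+ t) :+ (:- e) :* f := e :+ ((f :+ s) :+ t)) ≈-refl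

  neg-one-plus : ∀ e → - 1# + (1# + e) ≈ e
  neg-one-plus = solve 1 (λ e → :- 𝟙 :+ (𝟙 :+ e) := e) ≈-refl

  add-diff : ∀ p q → p + (q - p) ≈ q
  add-diff = solve 2 (λ p q → p :+ (q :- p) := q) ≈-refl

  linear-step : ∀ a d t A D → (a + t * d) + (A + t * D) ≈ (a + A) + t * (d + D)
  linear-step = solve 5 (λ a d t A D →
    (a :+ t :* d) :+ (A :+ t :* D) := (a :+ A) :+ t :* (d :+ D)) ≈-refl

  linear-base : ∀ t → 0# ≈ 0# + t * 0#
  linear-base = solve 1 (λ t → 𝟘 := 𝟘 :+ t :* 𝟘) ≈-refl

  flow-step : ∀ a b c T A B → (a * c - T * (b - a)) + (A * c - T * (B - A)) ≈
                (a + A) * c - T * ((b + B) - (a + A))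
  flow-step = solve 6 (λ a b c T A B →
    (a :* c :- T :* (b :- a)) :+ (A :* c :- T :* (B :- A))
    := (a :+ A) :* c :- T :* ((b :+ B) :- (a :+ A))) ≈-refl

  flow-base : ∀ c T → 0# ≈ 0# * c - T * (0# - 0#)
  flow-base = solve 2 (λ c T → 𝟘 := 𝟘 :* c :- T :* (𝟘 :- 𝟘)) ≈-refl

  flow-total : ∀ A B T → A * (B - A) - T * (B - A) ≈ (A - T) * (B - A)
  flow-total = solve 3 (λ A B T → A :* (B :- A) :- T :* (B :- A) := (A :- T) :* (B :- A)) ≈-refl

  flow-mono : ∀ a c h s → (a * c - s) + a * (h - c) ≈ a * h - s
  flow-mono = solve 4 (λ a c h s → (a :* c :- s) :+ a :* (h :- c) := a :* h :- s) ≈-refl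

  gap-bound : ∀ A B T h → (B - A) + ((T - (B - h)) + (A - T)) ≈ h
  gap-bound = solve 4 (λ A B T h → (B :- A) :+ ((T :- (B :- h)) :+ (A :- T)) := h) ≈-refl

  lower-index : ∀ b p R → (b + R) - (b - p) ≈ p + R
  lower-index = solve 3 (λ b p R → (b :+ R) :- (b :- p) := p :+ R) ≈-refl

  down : ∀ x d s → x + s * d + s * (- d) ≈ x
  down = solve 3 (λ x d s → x :+ s :* d :+ s :* (:- d) := x) ≈-refl

  down-to : ∀ x d s t → x - t * (- d) + (t - s) * (- d) ≈ x + s * d
  down-to = solve 4 (λ x d s t → x :- t :* (:- d) :+ (t :- s) :* (:- d) := x :+ s :* d) ≈-refl

  down-eq : ∀ x d t → x + t * d ≈ x - t * (- d)
  down-eq = solve 3 (λ x d t → x :+ t :* d := x :- t :* (:- d)) ≈-refl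

  sub-diff : ∀ x l → x - (x - l) ≈ l
  sub-diff = solve 2 (λ x l → x :- (x :- l) := l) ≈-refl

  up-to : ∀ x d s t → x + s * d + (t - s) * d ≈ x + t * d
  up-to = solve 4 (λ x d s t → x :+ s :* d :+ (t :- s) :* d := x :+ t :* d) ≈-refl

  rate : ∀ a h T l r → (a * h - T * l) * r ≈ (r * a) * h - T * (l * r)
  rate = solve 5 (λ a h T l r → (a :* h :- T :* l) :* r := (r :* a) :* h :- T :* (l :* r)) ≈-refl

  rate-sum : ∀ T x X h R → T * (x + X) + ((h - T * x) + R) ≈ h + (T * X + R)
  rate-sum = solve 5 (λ T x X h R →
    T :* (x :+ X) :+ ((h :- T :* x) :+ R) := h :+ (T :* X :+ R)) ≈-refl

  rate-base : ∀ T → T * 0# + 0# ≈ 0#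
  rate-base = solve 1 (λ T → T :* 𝟘 :+ 𝟘 := 𝟘) ≈-refl

  ratio : ∀ a l r → a + l * (r * a) ≈ a * (1# + l * r)
  ratio = solve 3 (λ a l r → a :+ l :* (r :* a) := a :* (𝟙 :+ l :* r)) ≈-refl

  ratio-shift : ∀ a t d r → a + t * (d * (r * a)) ≈ a * (1# + t * (d * r))
  ratio-shift = solve 4 (λ a t d r → a :+ t :* (d :* (r :* a)) := a :* (𝟙 :+ t :* (d :* r))) ≈-refl

  shift-ratio : ∀ a t d r → (a + t * d) * r ≈ r * a + t * (d * r)
  shift-ratio = solve 4 (λ a t d r → (a :+ t :* d) :* r := r :* a :+ t :* (d :* r)) ≈-refl

  telescope-step : ∀ b c x B → (c - b) + x + (B - c - x) ≈ B - b
  telescope-step = solve 4 (λ b c x B → (c :- b) :+ x :+ (B :- c :- x) := B :- b) ≈-refl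

  inverse-diff : ∀ a b x y → y + x * y * (b - a) ≈ y + (x * (y * b) - y * (x * a))
  inverse-diff = solve 4 (λ a b x y → 
    y :+ x :* y :* (b :- a) := y :+ (x :* (y :* b) :- y :* (x :* a))) ≈-refl

  inverse-end : ∀ x y → y + (x * 1# - y * 1#) ≈ x
  inverse-end = solve 2 (λ x y → y :+ (x :* 𝟙 :- y :* 𝟙) := x) ≈-refl

  left-end : ∀ a e → a + e ≈ (a + 1#) + - (1# - e) * 1#
  left-end = solve 2 (λ a e → a :+ e := (a :+ 𝟙) :+ (:- (𝟙 :- e)) :* 𝟙) ≈-refl

  left-end′ : ∀ b e i → b + - (1# - e) * (i * b) ≈ b * (1# + - ((1# - e) * i))
  left-end′ = solve 3 (λ b e i →
    b :+ (:- (𝟙 :- e)) :* (i :* b) := b :* (𝟙 :+ :- ((𝟙 :- e) :* i))) ≈-refl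

  multiples-step : ∀ a K N → (1# + K) * a + ((N + 1# - K * (a + 1#)) + (K - (1# + a))) ≈ N
  multiples-step = solve 3 (λ a K N →
    (𝟙 :+ K) :* a :+ ((N :+ 𝟙 :- K :* (a :+ 𝟙)) :+ (K :- (𝟙 :+ a))) := N) ≈-refl

  square : ∀ a → (1# + a) * a + (1# + a) ≈ (a + 1#) * (a + 1#)
  square = solve 1 (λ a → (𝟙 :+ a) :* a :+ (𝟙 :+ a) := (a :+ 𝟙) :* (a :+ 𝟙)) ≈-refl

  sub-mono : ∀ x y p → (x - y) + (- p - x) ≈ - y - p
  sub-mono = solve 3 (λ x y p → (x :- y) :+ (:- p :- x) := :- y :- p) ≈-refl

  slack : ∀ q₁ q₂ w₁ w₂ ε I J →
    (q₁ + w₂) + (((- w₂ - - w₁) + J - I) + ((I - (q₁ + q₂)) - ε * I) + ε * (I - J) + (q₂ - w₁))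
    ≈ (1# - ε) * J
  slack = solve 7 (λ q₁ q₂ w₁ w₂ ε I J →
    (q₁ :+ w₂)
    :+ (((:- w₂ :- :- w₁) :+ J :- I) :+ ((I :- (q₁ :+ q₂)) :- ε :* I) :+ ε :* (I :- J) :+ (q₂ :- w₁))
    := (𝟙 :- ε) :* J) ≈-refl

  square-diff : ∀ x y → x * x + (y - x) * (x + y) ≈ y * y
  square-diff = solve 2 (λ x y → x :* x :+ (y :- x) :* (x :+ y) := y :* y) ≈-refl

  add-sub : ∀ p q → (p + q) - q ≈ p
  add-sub = solve 2 (λ p q → (p :+ q) :- q := p) ≈-refl

  sub-sub : ∀ p q → (p - q) - p ≈ - q
  sub-sub = solve 2 (λ p q → (p :- q) :- p := :- q) ≈-refl

open RingIdentities ℚP.+-*-commutativeRing Lemmas.ℤ⟶ℚ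

module IntervalSums where
  open import Data.Rational.Base using (ℚ; 0ℚ; 1ℚ; _+_; _*_; _-_; -_; _≤_; _<_)
  open import Algebra.Properties.CommutativeMonoid.Sum ℚP.+-0-commutativeMonoid
    using (sum; sum-cong-≗; ∑-distrib-+)
  open import Algebra.Properties.CommutativeMonoid.Sum ℚP.*-1-commutativeMonoid
    using () renaming (sum to product; sum-remove to product-remove; ∑-permute to product-permute)
  open Lemmas

  -- The AM-GM inequality.

  ΣL : List ℚ → ℚ
  ΣL = foldr _+_ 0ℚ

  -- Factors are stored by their excess over 1, so that AM-GM compares the total excess with 0 and
  -- the product with 1.
  Π1+ : List ℚ → ℚ
  Π1+ = foldr (λ e p → (1ℚ + e) * p) 1ℚ

  0≤1+ : ∀ {e} → - 1ℚ ≤ e → 0ℚ ≤ 1ℚ + e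
  0≤1+ = ℚP.+-monoʳ-≤ 1ℚ

  -1≤0 : - 1ℚ ≤ 0ℚ
  -1≤0 = ℚP.neg-antimono-≤ 0≤1

  0≤-e : ∀ {e} → e ≤ 0ℚ → 0ℚ ≤ - e
  0≤-e = ℚP.neg-antimono-≤

  NonNeg NonPos : List ℚ → Set
  NonNeg = All (0ℚ ≤_)
  NonPos = All (λ e → - 1ℚ ≤ e × e ≤ 0ℚ)

  Π1+-nonNeg : ∀ {es} → All (- 1ℚ ≤_) es → 0ℚ ≤ Π1+ es
  Π1+-nonNeg []       = 0≤1
  Π1+-nonNeg (h ∷ hs) = nonNeg* (0≤1+ h) (Π1+-nonNeg hs)

  ΣL-nonNeg : ∀ {es} → NonNeg es → 0ℚ ≤ ΣL es
  ΣL-nonNeg []       = ℚP.≤-refl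
  ΣL-nonNeg (h ∷ hs) = ℚP.+-mono-≤ h (ΣL-nonNeg hs)

  *≤1 : ∀ {e p} → 0ℚ ≤ p → e ≤ 0ℚ → p ≤ 1ℚ → (1ℚ + e) * p ≤ 1ℚ
  *≤1 {e} {p} 0≤p e≤0 p≤1 = ℚP.≤-trans
    (ℚP.*-monoʳ-≤-nonNeg p ⦃ ℚ.nonNegative 0≤p ⦄ (ℚP.+-monoʳ-≤ 1ℚ e≤0))
    (subst (_≤ 1ℚ) (sym (ℚP.*-identityˡ p)) p≤1)

  Π1+-nonPos : ∀ {es} → NonPos es → Π1+ es ≤ 1ℚ
  Π1+-nonPos []                  = ℚP.≤-refl
  Π1+-nonPos ((h , e≤0) ∷ hs) = *≤1 (Π1+-nonNeg (All.map proj₁ hs)) e≤0 (Π1+-nonPos hs)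

  Π1+-zero : ∀ {es} → NonNeg es → ΣL es ≤ 0ℚ → Π1+ es ≤ 1ℚ
  Π1+-zero [] _ = ℚP.≤-refl
  Π1+-zero {e ∷ es} (h ∷ hs) Σ≤0 = *≤1 (Π1+-nonNeg (All.map (ℚP.≤-trans -1≤0) hs))
    (ℚP.≤-trans (undiff≤ {e} (ΣL-nonNeg hs) refl) Σ≤0)
    (Π1+-zero hs (ℚP.≤-trans (subst (_≤ e + ΣL es) (ℚP.+-identityˡ _)
      (ℚP.+-monoˡ-≤ (ΣL es) h)) Σ≤0))

  -1≤e+f+ef : ∀ {e f} → - 1ℚ ≤ e → - 1ℚ ≤ f → - 1ℚ ≤ e + f + e * f
  -1≤e+f+ef {e} {f} h k = undiff≤ (nonNeg* (0≤1+ h) (0≤1+ k)) (product-excess e f)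

  -- 1 + e and 1 + f on different sides of 1 are replaced by their product, whose
  -- excess e + f + e f is at most e + f.
  am-gm-split : ∀ us e vs → NonNeg us → - 1ℚ ≤ e → NonPos vs →
                e + (ΣL us + ΣL vs) ≤ 0ℚ → (1ℚ + e) * (Π1+ us * Π1+ vs) ≤ 1ℚ
  am-gm-split us e vs hu he hv Σ≤0 with ℚP.≤-total 0ℚ e
  am-gm-split us e [] hu he [] Σ≤0 | inj₁ 0≤e = subst (λ p → (1ℚ + e) * p ≤ 1ℚ)
    (sym (ℚP.*-identityʳ (Π1+ us)))
    (Π1+-zero (0≤e ∷ hu) (subst (λ s → e + s ≤ 0ℚ) (ℚP.+-identityʳ (ΣL us)) Σ≤0))
  am-gm-split us e (f ∷ vs) hu he ((-1≤f , f≤0) ∷ hv) Σ≤0 | inj₁ 0≤e =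
    subst (_≤ 1ℚ) (trans (product-excess-* e f (Π1+ us * Π1+ vs))
        (cong ((1ℚ + e) *_) (*-swap (1ℚ + f) (Π1+ us) (Π1+ vs))))
      (am-gm-split us (e + f + e * f) vs hu (-1≤e+f+ef he -1≤f) hv
        (ℚP.≤-trans (undiff≤ (nonNeg* 0≤e (0≤-e f≤0)) (excess-sumʳ e f (ΣL us) (ΣL vs))) Σ≤0))
  am-gm-split [] e vs [] he hv Σ≤0 | inj₂ e≤0 = subst (λ p → (1ℚ + e) * p ≤ 1ℚ)
    (sym (ℚP.*-identityˡ (Π1+ vs))) (Π1+-nonPos ((he , e≤0) ∷ hv))
  am-gm-split (f ∷ us) e vs (0≤f ∷ hu) he hv Σ≤0 | inj₂ e≤0 =
    subst (_≤ 1ℚ) (trans (product-excess-* e f (Π1+ us * Π1+ vs))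
        (cong ((1ℚ + e) *_) (sym (ℚP.*-assoc (1ℚ + f) (Π1+ us) (Π1+ vs)))))
      (am-gm-split us (e + f + e * f) vs hu (-1≤e+f+ef he (ℚP.≤-trans -1≤0 0≤f)) hv
        (ℚP.≤-trans (undiff≤ (nonNeg* (0≤-e e≤0) 0≤f) (excess-sumˡ e f (ΣL us) (ΣL vs))) Σ≤0))

  -- Sorts the excesses by sign into `us` and `vs`; `am-gm-split` then starts from the neutral
  -- excess 0.
  am-gm-acc : ∀ es us vs → All (- 1ℚ ≤_) es → NonNeg us → NonPos vs →
              ΣL es + (ΣL us + ΣL vs) ≤ 0ℚ → Π1+ es * (Π1+ us * Π1+ vs) ≤ 1ℚ
  am-gm-acc [] us vs [] hu hv Σ≤0 = am-gm-split us 0ℚ vs hu -1≤0 hv Σ≤0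
  am-gm-acc (e ∷ es) us vs (h ∷ hs) hu hv Σ≤0 with ℚP.≤-total 0ℚ e
  ... | inj₁ 0≤e = subst (_≤ 1ℚ)
    (trans (cong (Π1+ es *_) (ℚP.*-assoc (1ℚ + e) (Π1+ us) (Π1+ vs)))
      (*-shift (Π1+ es) (1ℚ + e) (Π1+ us * Π1+ vs)))
    (am-gm-acc es (e ∷ us) vs hs (0≤e ∷ hu) hv
      (subst (_≤ 0ℚ)
        (sym (trans (cong (ΣL es +_) (ℚP.+-assoc e (ΣL us) (ΣL vs)))
          (+-shift (ΣL es) e (ΣL us + ΣL vs)))) Σ≤0))
  ... | inj₂ e≤0 = subst (_≤ 1ℚ)
    (trans (cong (Π1+ es *_) (*-swap (Π1+ us) (1ℚ + e) (Π1+ vs)))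
      (*-shift (Π1+ es) (1ℚ + e) (Π1+ us * Π1+ vs)))
    (am-gm-acc es us (e ∷ vs) hs hu ((h , e≤0) ∷ hv)
      (subst (_≤ 0ℚ)
        (sym (trans (cong (ΣL es +_) (+-swap (ΣL us) e (ΣL vs)))
          (+-shift (ΣL es) e (ΣL us + ΣL vs)))) Σ≤0))

  -- This is AM-GM for the numbers `1 + e`, whose mean is at most 1; in this form no roots occur.
  am-gm : ∀ {es} → All (- 1ℚ ≤_) es → ΣL es ≤ 0ℚ → Π1+ es ≤ 1ℚ
  am-gm {es} hs Σ≤0 = subst (_≤ 1ℚ) (ℚP.*-identityʳ (Π1+ es))
    (am-gm-acc es [] [] hs [] [] (subst (_≤ 0ℚ) (sym (ℚP.+-identityʳ (ΣL es))) Σ≤0))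

  -- Finite sums and products, predecessors and telescoping.

  sum-mono : ∀ {k} {v w : Fin k → ℚ} → (∀ j → v j ≤ w j) → sum v ≤ sum w
  sum-mono {zero}  h = ℚP.≤-refl
  sum-mono {suc k} h = ℚP.+-mono-≤ (h zero) (sum-mono (h ∘ suc))

  sum-* : ∀ {k} t (v : Fin k → ℚ) → sum (λ j → t * v j) ≡ t * sum v
  sum-* {zero}  t v = sym (ℚP.*-zeroʳ t)
  sum-* {suc k} t v = trans (cong (t * v zero +_) (sum-* t (v ∘ suc)))
    (sym (ℚP.*-distribˡ-+ t (v zero) (sum (v ∘ suc))))

  ΣL-tabulate : ∀ {k} (v : Fin k → ℚ) → ΣL (tabulate v) ≡ sum v
  ΣL-tabulate {zero}  v = refl
  ΣL-tabulate {suc k} v = cong (v zero +_) (ΣL-tabulate (v ∘ suc))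

  product-nonNeg : ∀ {k} {v : Fin k → ℚ} → (∀ j → 0ℚ ≤ v j) → 0ℚ ≤ product v
  product-nonNeg {zero}  h = 0≤1
  product-nonNeg {suc k} h = nonNeg* (h zero) (product-nonNeg (h ∘ suc))

  product-factor : ∀ {k} {v w e : Fin k → ℚ} → (∀ j → w j ≡ v j * (1ℚ + e j)) →
                   product w ≡ product v * Π1+ (tabulate e)
  product-factor {zero}  h = refl
  product-factor {suc k} {v} {w} {e} h = trans
    (cong₂ _*_ (h zero) (product-factor (h ∘ suc)))
    (*-interchange (v zero) (1ℚ + e zero) (product (v ∘ suc)) (Π1+ (tabulate (e ∘ suc))))

  -- Used with `b = 0` as a wall below the first interval and, for negated reciprocals, with
  -- `b = - w₁`.
  prev : ∀ {k} → ℚ → (Fin k → ℚ) → Fin k → ℚ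
  prev b v zero    = b
  prev b v (suc j) = v (inject₁ j)

  prev-cases : ∀ {k} b (v : Fin k → ℚ) j →
               prev b v j ≡ b ⊎ (∃ λ i → toℕ j ≡ suc (toℕ i) × prev b v j ≡ v i)
  prev-cases b v zero    = inj₁ refl
  prev-cases b v (suc j) = inj₂ (inject₁ j , cong suc (sym (FinP.toℕ-inject₁ j)) , refl)

  prev-tail : ∀ {k} b (v : Fin (suc k) → ℚ) j → prev b v (suc j) ≡ prev (v zero) (v ∘ suc) j
  prev-tail b v zero    = refl
  prev-tail b v (suc j) = refl

  -- The sum collapses to the last value minus `b`, and to 0 for the empty sequence, where `b ≤ B`
  -- enters.
  telescope : ∀ {k} {b B} {v : Fin k → ℚ} → b ≤ B → (∀ j → v j ≤ B) →
              sum (λ j → v j - prev b v j) ≤ B - b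
  telescope {zero}          b≤B _ = diff≤ b≤B
  telescope {suc k} {b} {B} {v} b≤B h = undiff≤
    (diff≤ (ℚP.≤-trans
      (ℚP.≤-reflexive (sum-cong-≗ λ j → cong (λ p → v (suc j) - p) (prev-tail b v j)))
      (telescope (h zero) (h ∘ suc))))
    (telescope-step b (v zero) (sum λ j → v (suc j) - v (inject₁ j)) B)

  ≤∧≢⇒<ℚ : ∀ {p q} → p ≤ q → p ≢ q → p < q
  ≤∧≢⇒<ℚ p≤q p≢q = ℚP.≰⇒> λ q≤p → p≢q (ℚP.≤-antisym p≤q q≤p)

  -- Exit times of points in linear motion.

  module _ (lo x hi d : ℚ) where
    -- Covering all times up to `t` lets `exit` pass to the smallest of several exit times.
    Inside : ℚ → Set
    Inside t = ∀ s → 0ℚ ≤ s → s ≤ t → lo ≤ x + s * d × x + s * d ≤ hi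

    Touch : ℚ → Set
    Touch t = x + t * d ≡ lo ⊎ x + t * d ≡ hi

    -- A point with velocity `d` reaches the end ahead of it at time `(x - lo) / (- d)` or
    -- `(hi - x) / d`.
    exit-time : lo < x → x < hi → d ≡ 0ℚ ⊎ (∃ λ t → 0ℚ ≤ t × Inside t × Touch t)
    exit-time lo<x x<hi with ℚP.<-cmp d 0ℚ
    ... | tri≈ _ d≡0 _ = inj₁ d≡0
    ... | tri< d<0 _ _ with ℚP.neg-antimono-< d<0
    ...   | 0<-d with quotient (x - lo) 0<-d
    ...     | t , eq = inj₂ (t , 0≤t , inside , inj₁ (trans (down-eq x d t) end))
      where
      0≤t : 0ℚ ≤ t
      0≤t = ℚP.<⇒≤ (pos-factor 0<-d (subst (0ℚ <_) (sym eq) (diff lo<x)))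
      end : x - t * (- d) ≡ lo
      end = trans (cong (λ q → x - q) eq) (sub-diff x lo)
      inside : Inside t
      inside s 0≤s s≤t =
          subst (_≤ x + s * d) end
            (undiff≤ (nonNeg* (diff≤ s≤t) (ℚP.<⇒≤ 0<-d)) (down-to x d s t))
        , ℚP.≤-trans (undiff≤ (nonNeg* 0≤s (ℚP.<⇒≤ 0<-d)) (down x d s)) (ℚP.<⇒≤ x<hi)
    exit-time lo<x x<hi | tri> _ _ 0<d with quotient (hi - x) 0<d
    ... | t , eq = inj₂ (t , 0≤t , inside , inj₂ end)
      where
      0≤t : 0ℚ ≤ t
      0≤t = ℚP.<⇒≤ (pos-factor 0<d (subst (0ℚ <_) (sym eq) (diff x<hi)))
      end : x + t * d ≡ hi
      end = trans (cong (x +_) eq) (add-diff x hi)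
      inside : Inside t
      inside s 0≤s s≤t =
          ℚP.≤-trans (ℚP.<⇒≤ lo<x) (undiff≤ {x} (nonNeg* 0≤s (ℚP.<⇒≤ 0<d)) refl)
        , subst (x + s * d ≤_) end (undiff≤ (nonNeg* (diff≤ s≤t) (ℚP.<⇒≤ 0<d)) (up-to x d s t))

  -- The earliest of the individual exit times serves for all points; points at rest impose no
  -- limit.
  exit : ∀ {k} (lo x hi d : Fin k → ℚ) → (∀ j → lo j < x j) → (∀ j → x j < hi j) →
         (∀ j → d j ≡ 0ℚ) ⊎
         (∃ λ t → 0ℚ ≤ t × (∀ j → Inside (lo j) (x j) (hi j) (d j) t) ×
           ∃ λ j → Touch (lo j) (x j) (hi j) (d j) t)
  exit {zero}  lo x hi d lo<x x<hi = inj₁ λ ()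
  exit {suc k} lo x hi d lo<x x<hi
    with exit-time (lo zero) (x zero) (hi zero) (d zero) (lo<x zero) (x<hi zero)
       | exit (lo ∘ suc) (x ∘ suc) (hi ∘ suc) (d ∘ suc) (lo<x ∘ suc) (x<hi ∘ suc)
  ... | inj₁ d₀≡0 | inj₁ d≡0 = inj₁ λ { zero → d₀≡0 ; (suc j) → d≡0 j }
  ... | inj₁ d₀≡0 | inj₂ (t , 0≤t , inside , j , touch) =
    inj₂ (t , 0≤t , (λ { zero s _ _ → still s ; (suc j) → inside j }) , suc j , touch)
    where
    still : ∀ s → lo zero ≤ x zero + s * d zero × x zero + s * d zero ≤ hi zero
    still s = subst (λ y → lo zero ≤ y × y ≤ hi zero)
      (sym (trans (cong (x zero +_) (trans (cong (s *_) d₀≡0) (ℚP.*-zeroʳ s)))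
        (ℚP.+-identityʳ (x zero))))
      (ℚP.<⇒≤ (lo<x zero) , ℚP.<⇒≤ (x<hi zero))
  ... | inj₂ (t , 0≤t , inside , touch) | inj₁ d≡0 =
    inj₂ (t , 0≤t , (λ { zero → inside ; (suc j) s _ _ → still j s }) , zero , touch)
    where
    still : ∀ j s → lo (suc j) ≤ x (suc j) + s * d (suc j) × x (suc j) + s * d (suc j) ≤ hi (suc j)
    still j s = subst (λ y → lo (suc j) ≤ y × y ≤ hi (suc j))
      (sym (trans (cong (x (suc j) +_) (trans (cong (s *_) (d≡0 j)) (ℚP.*-zeroʳ s)))
        (ℚP.+-identityʳ (x (suc j)))))
      (ℚP.<⇒≤ (lo<x (suc j)) , ℚP.<⇒≤ (x<hi (suc j)))
  ... | inj₂ (t , 0≤t , inside , touch) | inj₂ (t′ , 0≤t′ , inside′ , j , touch′)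
    with ℚP.≤-total t t′
  ...   | inj₁ t≤t′ = inj₂ (t , 0≤t
    , (λ { zero → inside ; (suc j) s 0≤s s≤t → inside′ j s 0≤s (ℚP.≤-trans s≤t t≤t′) })
    , zero , touch)
  ...   | inj₂ t′≤t = inj₂ (t′ , 0≤t′
    , (λ { zero s 0≤s s≤t′ → inside s 0≤s (ℚP.≤-trans s≤t′ t′≤t) ; (suc j) → inside′ j })
    , suc j , touch′)

  -- Sums of intervals, given by lists of indices.

  infix 8 _∙_

  -- A list encodes a sum with repetition; this is the scalar product of its multiplicities with
  -- `v`.
  _∙_ : ∀ {k} → List (Fin k) → (Fin k → ℚ) → ℚ
  n ∙ v = foldr (λ j s → v j + s) 0ℚ n

  module _ {k} {v w : Fin k → ℚ} where
    ∙-mono : ∀ {n} → All (λ j → v j ≤ w j) n → n ∙ v ≤ n ∙ w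
    ∙-mono []       = ℚP.≤-refl
    ∙-mono (h ∷ hs) = ℚP.+-mono-≤ h (∙-mono hs)

    ∙-mono-< : (∀ j → v j < w j) → ∀ i n → (i ∷ n) ∙ v < (i ∷ n) ∙ w
    ∙-mono-< h i n = ℚP.+-mono-<-≤ (h i) (∙-mono (All.universal (ℚP.<⇒≤ ∘ h) n))

    ∙-linear : ∀ t n → n ∙ (λ j → v j + t * w j) ≡ n ∙ v + t * n ∙ w
    ∙-linear t []      = linear-base t
    ∙-linear t (j ∷ n) = trans (cong (v j + t * w j +_) (∙-linear t n))
      (linear-step (v j) (w j) t (n ∙ v) (n ∙ w))

  module _ {k} (v : Fin k → ℚ) where
    ∙-insert : ∀ m j n → (m ++ j ∷ n) ∙ v ≡ v j + (m ++ n) ∙ v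
    ∙-insert []      j n = refl
    ∙-insert (i ∷ m) j n = trans (cong (v i +_) (∙-insert m j n)) (+-swap (v i) (v j) _)

    ∙-replicate : ∀ m j → replicate m j ∙ v ≡ (ℤ.+ m ℚ./ 1) * v j
    ∙-replicate zero    j = sym (ℚP.*-zeroˡ (v j))
    ∙-replicate (suc m) j = trans (cong (v j +_) (∙-replicate m j))
      (trans (eq5 (v j) (ℤ.+ m ℚ./ 1)) (cong (_* v j) (sym (suc/1 m))))

    ∙-map : ∀ {k′} (f : Fin k′ → Fin k) n → map f n ∙ v ≡ n ∙ (v ∘ f)
    ∙-map f []      = refl
    ∙-map f (j ∷ n) = cong (v (f j) +_) (∙-map f n)

  ∙-nonNeg : ∀ {k} {v : Fin k → ℚ} → (∀ j → 0ℚ ≤ v j) → ∀ n → 0ℚ ≤ n ∙ v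
  ∙-nonNeg h []      = ℚP.≤-refl
  ∙-nonNeg h (j ∷ n) = ℚP.+-mono-≤ (h j) (∙-nonNeg h n)

  -- Lowering an index by one, or deleting the index 0, reduces this by exactly 1, so `avoids′` can
  -- use it as its induction measure.
  rank : ∀ {k} → List (Fin k) → ℕ
  rank = foldr (λ j s → suc (toℕ j) ℕ.+ s) 0

  rank-insert : ∀ {k} m (j : Fin k) n → rank (m ++ j ∷ n) ≡ suc (toℕ j) ℕ.+ rank (m ++ n)
  rank-insert []      j n = refl
  rank-insert (i ∷ m) j n = trans (cong (suc (toℕ i) ℕ.+_) (rank-insert m j n))
    (ℕ-swap (suc (toℕ i)) (suc (toℕ j)) (rank (m ++ n)))

  punchIn-mono-< : ∀ {k} i (l m : Fin k) → toℕ l ℕ.< toℕ m → toℕ (punchIn i l) ℕ.< toℕ (punchIn i m)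
  punchIn-mono-< i l m l<m = ℕP.≰⇒> λ h → ℕP.<⇒≱ l<m (FinP.punchIn-cancel-≤ i m l h)

  -- Bad families of intervals and the bound on their products.

  module Families (T B : ℚ) (0<T : 0ℚ < T) (0≤B : 0ℚ ≤ B) where

    -- `avoids` is badness for `T`. Intervals may be empty, and `below` keeps `T` from being the
    -- point at which two intervals are merged.
    record Family {k} (α β : Fin k → ℚ) : Set where
      field
        nonNeg    : ∀ i → 0ℚ ≤ α i
        ordered   : ∀ i → α i ≤ β i
        below     : ∀ i → β i < T
        bounded   : ∀ i → β i ≤ B
        separated : ∀ i j → toℕ i ℕ.< toℕ j → β i ≤ α j
        avoids    : ∀ n → T ≤ n ∙ α ⊎ n ∙ β ≤ T

    open Family

    -- `es` holds the ratios `(β - α) / α` of the family at which the flow stops, which may have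
    -- fewer intervals.
    Bound : ∀ {k} → (Fin k → ℚ) → (Fin k → ℚ) → Set
    Bound α β = ∃ λ es → NonNeg es × T * ΣL es ≤ B × product β ≤ product α * Π1+ es

    bound-mono : ∀ {k} (α α′ β : Fin k → ℚ) → product α′ ≤ product α → Bound α′ β → Bound α β
    bound-mono α α′ β h (es , 0≤es , Σ≤ , Π≤) = es , 0≤es , Σ≤ , ℚP.≤-trans Π≤
      (ℚP.*-monoʳ-≤-nonNeg (Π1+ es)
        ⦃ ℚ.nonNegative (Π1+-nonNeg (All.map (ℚP.≤-trans -1≤0) 0≤es)) ⦄ h)

    module _ {k} (α β : Fin (suc k) → ℚ) where
      -- An empty interval contributes the same factor to both products.
      drop-bound : ∀ i → 0ℚ ≤ β i → α i ≡ β i →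
                   Bound (α ∘ punchIn i) (β ∘ punchIn i) → Bound α β
      drop-bound i 0≤βi eq (es , 0≤es , Σ≤ , Π≤) = es , 0≤es , Σ≤ , (begin
        product β                                   ≡⟨ product-remove β ⟩
        β i * product (β ∘ punchIn i)               ≤⟨ ℚP.*-monoˡ-≤-nonNeg (β i)
                                                       ⦃ ℚ.nonNegative 0≤βi ⦄ Π≤ ⟩
        β i * (product (α ∘ punchIn i) * Π1+ es)    ≡⟨ sym (ℚP.*-assoc (β i) _ (Π1+ es)) ⟩
        β i * product (α ∘ punchIn i) * Π1+ es      ≡⟨ cong (λ b → b * product (α ∘ punchIn i) * Π1+ es)
                                                       (sym eq) ⟩
        α i * product (α ∘ punchIn i) * Π1+ es      ≡⟨ cong (_* Π1+ es) (sym (product-remove α)) ⟩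
        product α * Π1+ es                          ∎)
        where open ℚP.≤-Reasoning

      drop-family : Family α β → ∀ i → Family (α ∘ punchIn i) (β ∘ punchIn i)
      drop-family F i = record
        { nonNeg    = nonNeg F ∘ punchIn i
        ; ordered   = ordered F ∘ punchIn i
        ; below     = below F ∘ punchIn i
        ; bounded   = bounded F ∘ punchIn i
        ; separated = λ l m l<m → separated F _ _ (punchIn-mono-< i l m l<m)
        ; avoids    = λ n → subst₂ (λ a b → T ≤ a ⊎ b ≤ T)
            (∙-map α (punchIn i) n) (∙-map β (punchIn i) n) (avoids F (map (punchIn i) n))
        }

    -- Merging two touching intervals.

    module Merge {k} {α β : Fin (suc k) → ℚ} (F : Family α β) (strict : ∀ i → α i < β i)
      {i j} (j≡1+i : toℕ j ≡ suc (toℕ i)) (αj≡βi : α j ≡ β i) where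

      -- The merged interval `(α i , β j)` takes the place of `j`: right ends skip `i`, and left
      -- ends use `τ`, which puts `i` where `j` would stand.
      τ : Fin k → Fin (suc k)
      τ = PC.transpose i j ∘ punchIn i

      τ-cases : ∀ m → (punchIn i m ≡ j × τ m ≡ i) ⊎ τ m ≡ punchIn i m
      τ-cases m with punchIn i m FinP.≟ i
      ... | yes eq = ⊥-elim (FinP.punchInᵢ≢i i m eq)
      ... | no  _ with punchIn i m FinP.≟ j
      ...   | yes eq = inj₁ (eq , refl)
      ...   | no  _  = inj₂ refl

      τ-strict : ∀ m → α (τ m) < β (punchIn i m)
      τ-strict m with τ-cases m
      ... | inj₂ eq rewrite eq = strict (punchIn i m)
      ... | inj₁ (eq , eq′) rewrite eq | eq′ = ℚP.<-≤-trans (strict i)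
        (subst (_≤ β j) αj≡βi (ordered F j))

      -- Each merged interval in `n` is replaced by `i` or `j` and moved to `m`. The choice `i` has
      -- the same left end, the choice `j` the same right end. So badness carries over unless `T` is
      -- at least the right total for `i` and at most the left total for `j`.
      avoids-merged : ∀ n m → T ≤ m ∙ α + n ∙ (α ∘ τ) ⊎ m ∙ β + n ∙ (β ∘ punchIn i) ≤ T
      avoids-merged [] m = subst₂ (λ a b → T ≤ a ⊎ b ≤ T)
        (sym (ℚP.+-identityʳ (m ∙ α))) (sym (ℚP.+-identityʳ (m ∙ β))) (avoids F m)
      avoids-merged (x ∷ n) m with τ-cases x
      ... | inj₂ eq rewrite eq = subst₂ (λ a b → T ≤ a ⊎ b ≤ T)
        (sym (+-shift (m ∙ α) (α (punchIn i x)) (n ∙ (α ∘ τ))))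
        (sym (+-shift (m ∙ β) (β (punchIn i x)) (n ∙ (β ∘ punchIn i))))
        (avoids-merged n (punchIn i x ∷ m))
      ... | inj₁ (eq , eq′) rewrite eq | eq′
        with avoids-merged n (i ∷ m) | avoids-merged n (j ∷ m)
      ...   | inj₁ T≤ | _ = inj₁ (subst (T ≤_) (sym (+-shift (m ∙ α) (α i) (n ∙ (α ∘ τ)))) T≤)
      ...   | inj₂ _ | inj₂ ≤T = inj₂ (subst (_≤ T)
        (sym (+-shift (m ∙ β) (β j) (n ∙ (β ∘ punchIn i)))) ≤T)
      ...   | inj₂ ≤T | inj₁ T≤ = ⊥-elim (absurd m n ≤T T≤)
        where
        gap : ∀ m n → m ∙ α + n ∙ (α ∘ τ) < m ∙ β + n ∙ (β ∘ punchIn i) ⊎ m ≡ [] × n ≡ []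
        gap (x ∷ m) n = inj₁ (ℚP.+-mono-<-≤ (∙-mono-< strict x m)
          (∙-mono (All.universal (ℚP.<⇒≤ ∘ τ-strict) n)))
        gap [] (x ∷ n) = inj₁ (ℚP.+-monoʳ-< 0ℚ (∙-mono-< τ-strict x n))
        gap [] [] = inj₂ (refl , refl)
        -- As `α j ≡ β i`, the remaining intervals would have a right total not exceeding their left
        -- total. Hence none remain, and `T ≤ β i` contradicts `below`.
        absurd : ∀ m n → (β i + m ∙ β) + n ∙ (β ∘ punchIn i) ≤ T →
                 T ≤ (α j + m ∙ α) + n ∙ (α ∘ τ) → ⊥
        absurd m n ≤T T≤ with gap m n
        ... | inj₂ (refl , refl) = ℚP.<-irrefl refl (ℚP.≤-<-trans T≤
          (subst (_< T) (trans (sym αj≡βi)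
            (sym (trans (ℚP.+-identityʳ (α j + 0ℚ)) (ℚP.+-identityʳ (α j))))) (below F i)))
        ... | inj₁ lt = ℚP.<-irrefl refl (ℚP.<-≤-trans
          (subst₂ _<_ (sym (ℚP.+-assoc (α j) (m ∙ α) (n ∙ (α ∘ τ))))
            (trans (cong (_+ (m ∙ β + n ∙ (β ∘ punchIn i))) αj≡βi)
              (sym (ℚP.+-assoc (β i) (m ∙ β) (n ∙ (β ∘ punchIn i)))))
            (ℚP.+-monoʳ-< (α j) lt))
          (ℚP.≤-trans ≤T T≤))

      merge-family : Family (α ∘ τ) (β ∘ punchIn i)
      merge-family = record
        { nonNeg    = nonNeg F ∘ τ
        ; ordered   = ℚP.<⇒≤ ∘ τ-strict
        ; below     = below F ∘ punchIn i
        ; bounded   = bounded F ∘ punchIn i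
        ; separated = sep
        ; avoids    = λ n → subst₂ (λ a b → T ≤ a ⊎ b ≤ T)
            (ℚP.+-identityˡ (n ∙ (α ∘ τ))) (ℚP.+-identityˡ (n ∙ (β ∘ punchIn i)))
            (avoids-merged n [])
        }
        where
        sep : ∀ l m → toℕ l ℕ.< toℕ m → β (punchIn i l) ≤ α (τ m)
        sep l m l<m with τ-cases m
        ... | inj₂ eq rewrite eq = separated F _ _ (punchIn-mono-< i l m l<m)
        ... | inj₁ (eq , eq′) rewrite eq′ = separated F _ _
          (ℕP.≤∧≢⇒< (ℕ.s≤s⁻¹ (subst (toℕ (punchIn i l) ℕ.<_) (trans (cong toℕ eq) j≡1+i)
              (punchIn-mono-< i l m l<m)))
            (FinP.punchInᵢ≢i i l ∘ FinP.toℕ-injective))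

      merge-bound : Bound (α ∘ τ) (β ∘ punchIn i) → Bound α β
      merge-bound b = bound-mono α (α ∘ PC.transpose i j) β
        (ℚP.≤-reflexive (sym (product-permute α (Perm.transpose i j))))
        (drop-bound (α ∘ PC.transpose i j) β i (ℚP.≤-trans (nonNeg F i) (ordered F i))
          α∘transpose≡β b)
        where
        α∘transpose≡β : α (PC.transpose i j i) ≡ β i
        α∘transpose≡β with i FinP.≟ i
        ... | yes _ = αj≡βi
        ... | no  ≢ = ⊥-elim (≢ refl)

    -- If `α j` were 0, a large multiple of the interval would reach from 0 to beyond `T`.
    positive : ∀ {k} {α β : Fin k → ℚ} → Family α β → ∀ j → 0ℚ < β j → 0ℚ < α j
    positive {α = α} {β} F j 0<βj = ℚP.≰⇒> λ αj≤0 → case archimedean (T + 1ℚ) 0<βj of λ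
      { (m , T+1≤) → case avoids F (replicate m j) of λ
        { (inj₁ T≤) → ℚP.<-irrefl refl (ℚP.<-≤-trans 0<T (ℚP.≤-trans T≤ (begin
            replicate m j ∙ α          ≡⟨ ∙-replicate α m j ⟩
            (ℤ.+ m ℚ./ 1) * α j        ≡⟨ cong ((ℤ.+ m ℚ./ 1) *_) (ℚP.≤-antisym αj≤0 (nonNeg F j)) ⟩
            (ℤ.+ m ℚ./ 1) * 0ℚ         ≡⟨ ℚP.*-zeroʳ (ℤ.+ m ℚ./ 1) ⟩
            0ℚ                         ∎)))
        ; (inj₂ ≤T) → ℚP.<-irrefl refl (begin-strict
            T                          <⟨ undiff 0<1 refl ⟩
            T + 1ℚ                     ≤⟨ T+1≤ ⟩
            multiple m (β j)           ≡⟨ trans (multiple-* m (β j)) (sym (∙-replicate β m j)) ⟩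
            replicate m j ∙ β          ≤⟨ ≤T ⟩
            T                          ∎)
        }
      }
      where open ℚP.≤-Reasoning

    -- The flow of the left ends and the preservation of badness.

    module Flow {k} {α β : Fin k → ℚ} (F : Family α β) where

      -- `d` is the velocity of the left ends. With 0 preceding the first interval, the `h j` of a
      -- nonempty family add up to its last right end.
      p h d : Fin k → ℚ
      p = prev 0ℚ β
      h j = β j - p j
      d j = α j * h j - T * (β j - α j)

      p-nonNeg : ∀ j → 0ℚ ≤ p j
      p-nonNeg j with prev-cases 0ℚ β j
      ... | inj₁ eq = ℚP.≤-reflexive (sym eq)
      ... | inj₂ (i , _ , eq) = subst (0ℚ ≤_) (sym eq) (ℚP.≤-trans (nonNeg F i) (ordered F i))

      p≤α : ∀ j → p j ≤ α j
      p≤α j with prev-cases 0ℚ β j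
      ... | inj₁ eq = subst (_≤ α j) (sym eq) (nonNeg F j)
      ... | inj₂ (i , j≡1+i , eq) = subst (_≤ α j) (sym eq)
        (separated F i j (ℕP.≤-reflexive (sym j≡1+i)))

      β≤p : ∀ i j → toℕ i ℕ.< toℕ j → β i ≤ p j
      β≤p i (suc j) (ℕ.s≤s i≤j) with toℕ i ℕP.≟ toℕ j
      ... | yes eq = ℚP.≤-reflexive (cong β
        (FinP.toℕ-injective (trans eq (sym (FinP.toℕ-inject₁ j)))))
      ... | no  ≢  = ℚP.≤-trans
        (separated F i (inject₁ j) (subst (toℕ i ℕ.<_) (sym (FinP.toℕ-inject₁ j)) (ℕP.≤∧≢⇒< i≤j ≢)))
        (ordered F (inject₁ j))

      lowered : ∀ m j n → T < (m ++ j ∷ n) ∙ β - h j → T < p j + (m ++ n) ∙ β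
      lowered m j n = subst (T <_) (trans (cong (_- h j) (∙-insert β m j n))
        (lower-index (β j) (p j) ((m ++ n) ∙ β)))

      -- From `n ∙ β - h j ≤ T ≤ n ∙ α` follows `c ≤ h j` for all `j` in `n`. Putting `c` for `h j`
      -- in `d j` can only lower `n ∙ d`, and then the sum is `(n ∙ α - T) * c`.
      n∙d-nonNeg : ∀ n → T ≤ n ∙ α → All (λ j → n ∙ β - h j ≤ T) n → 0ℚ ≤ n ∙ d
      n∙d-nonNeg n T≤ hs = ℚP.≤-trans
        (subst (0ℚ ≤_) (sym (trans (total n) (flow-total (n ∙ α) (n ∙ β) T)))
          (nonNeg* (diff≤ T≤) (diff≤ (∙-mono (All.universal (ordered F) n)))))
        (∙-mono (All.map bound hs))
        where
        c : ℚ
        c = n ∙ β - n ∙ α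
        total : ∀ m → m ∙ (λ j → α j * c - T * (β j - α j)) ≡ m ∙ α * c - T * (m ∙ β - m ∙ α)
        total []      = flow-base c T
        total (j ∷ m) = trans (cong (α j * c - T * (β j - α j) +_) (total m))
          (flow-step (α j) (β j) c T (m ∙ α) (m ∙ β))
        bound : ∀ {j} → n ∙ β - h j ≤ T → α j * c - T * (β j - α j) ≤ d j
        bound {j} le = undiff≤ (nonNeg* (nonNeg F j)
            (diff≤ (undiff≤ (ℚP.+-mono-≤ (diff≤ le) (diff≤ T≤))
              (gap-bound (n ∙ α) (n ∙ β) T (h j)))))
          (flow-mono (α j) c (h j) (T * (β j - α j)))

      module Shifted {t} (0≤t : 0ℚ ≤ t)
        (p≤α′ : ∀ j → p j ≤ α j + t * d j) (α′≤β : ∀ j → α j + t * d j ≤ β j) where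

        α′ : Fin k → ℚ
        α′ j = α j + t * d j

        α′-nonNeg : ∀ j → 0ℚ ≤ α′ j
        α′-nonNeg j = ℚP.≤-trans (p-nonNeg j) (p≤α′ j)

        -- If lowering some index of n keeps the total of the right endpoints above
        -- T, then n ∙ α′ is at least as large as for the lowered index; otherwise
        -- n ∙ d ≥ 0.
        avoids′ : ∀ r n → rank n ℕ.≤ r → T < n ∙ β → T ≤ n ∙ α′
        avoids′ r n rank≤ T< with Any.any? (λ j → T ℚP.<? n ∙ β - h j) n
        avoids′ r n rank≤ T< | no ¬any with avoids F n
        ... | inj₂ ≤T = ⊥-elim (ℚP.<-irrefl refl (ℚP.<-≤-trans T< ≤T))
        ... | inj₁ T≤ = ℚP.≤-trans T≤ (undiff≤
          (nonNeg* 0≤t (n∙d-nonNeg n T≤ (All.map ℚP.≮⇒≥ (AllP.¬Any⇒All¬ n ¬any))))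
          (sym (∙-linear {v = α} {w = d} t n)))
        avoids′ r n rank≤ T< | yes any with find any
        ... | j , j∈n , T<′ with ∈-∃++ j∈n
        ...   | xs , ys , refl with r | subst (ℕ._≤ r) (rank-insert xs j ys) rank≤
        ...     | suc r′ | ℕ.s≤s le with prev-cases 0ℚ β j
        -- The predecessor is the wall 0: lowering deletes `j`, and restoring it adds `α′ j ≥ 0` to
        -- the left total.
        ...       | inj₁ eq = subst (T ≤_) (sym (∙-insert α′ xs j ys))
          (ℚP.≤-trans
            (avoids′ r′ (xs ++ ys) (ℕP.m+n≤o⇒n≤o (toℕ j) le)
              (subst (T <_) (trans (cong (_+ (xs ++ ys) ∙ β) eq) (ℚP.+-identityˡ ((xs ++ ys) ∙ β)))
                (lowered xs j ys T<′)))
            (subst (_≤ α′ j + (xs ++ ys) ∙ α′) (ℚP.+-identityˡ ((xs ++ ys) ∙ α′))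
              (ℚP.+-monoˡ-≤ ((xs ++ ys) ∙ α′) (α′-nonNeg j))))
        -- Here `α′ i ≤ β i = p j ≤ α′ j`, so going back from `i` to `j` does not decrease the left
        -- total.
        ...       | inj₂ (i , j≡1+i , eq) = subst (T ≤_) (sym (∙-insert α′ xs j ys))
          (ℚP.≤-trans
            (avoids′ r′ (xs ++ i ∷ ys)
              (subst (ℕ._≤ r′) (trans (cong (ℕ._+ rank (xs ++ ys)) j≡1+i)
                (sym (rank-insert xs i ys))) le)
              (subst (T <_) (trans (cong (_+ (xs ++ ys) ∙ β) eq) (sym (∙-insert β xs i ys)))
                (lowered xs j ys T<′)))
            (subst (_≤ α′ j + (xs ++ ys) ∙ α′) (sym (∙-insert α′ xs i ys))
              (ℚP.+-monoˡ-≤ ((xs ++ ys) ∙ α′)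
                (ℚP.≤-trans (α′≤β i) (subst (_≤ α′ j) eq (p≤α′ j))))))

        shifted-family : Family α′ β
        shifted-family = record
          { nonNeg    = α′-nonNeg
          ; ordered   = α′≤β
          ; below     = below F
          ; bounded   = bounded F
          ; separated = λ i j i<j → ℚP.≤-trans (β≤p i j i<j) (p≤α′ j)
          ; avoids    = λ n → case n ∙ β ℚP.≤? T of λ
            { (yes ≤T) → inj₂ ≤T
            ; (no  ≰T) → inj₁ (avoids′ (rank n) n ℕP.≤-refl (ℚP.≰⇒> ≰T))
            }
          }

    -- Induction on the number of intervals.

    Event : ∀ {k} → (Fin k → ℚ) → (Fin k → ℚ) → Set
    Event α β = ∃ λ j → α j ≡ prev 0ℚ β j ⊎ α j ≡ β j

    -- Empty intervals are sought first, since merging requires all intervals to be nonempty. If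
    -- there are none, some left end meets its predecessor; this is not the wall 0, by `positive`,
    -- so two intervals merge.
    reduce : ∀ {k} {α β : Fin (suc k) → ℚ} →
             (∀ {α β : Fin k → ℚ} → Family α β → Bound α β) →
             Family α β → Event α β → Bound α β
    reduce {α = α} {β} bound F event with FinP.any? (λ i → α i ℚP.≟ β i)
    ... | yes (i , eq) = drop-bound α β i (ℚP.≤-trans (nonNeg F i) (ordered F i)) eq
      (bound (drop-family α β F i))
    ... | no  none = go event
      where
      strict : ∀ i → α i < β i
      strict i = ≤∧≢⇒<ℚ (ordered F i) λ eq → none (i , eq)
      go : Event α β → Bound α β
      go (j , inj₂ eq) = ⊥-elim (none (j , eq))
      go (j , inj₁ eq) with prev-cases 0ℚ β j
      ... | inj₁ p≡0 = ⊥-elim (ℚP.<-irrefl (sym (trans eq p≡0))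
        (positive F j (ℚP.≤-<-trans (nonNeg F j) (strict j))))
      ... | inj₂ (i , j≡1+i , p≡βi) = merge-bound (bound merge-family)
        where open Merge F strict j≡1+i (trans eq p≡βi)

    module Strict {k} {α β : Fin k → ℚ} (F : Family α β) (0<α : ∀ j → 0ℚ < α j) where
      open Flow F

      r : Fin k → ℚ
      r j = proj₁ (quotient 1ℚ (0<α j))

      r*α : ∀ j → r j * α j ≡ 1ℚ
      r*α j = proj₂ (quotient 1ℚ (0<α j))

      0≤r : ∀ j → 0ℚ ≤ r j
      0≤r j = ℚP.<⇒≤ (pos-factor (0<α j) (subst (0ℚ <_) (sym (r*α j)) 0<1))

      *r*α : ∀ j q → q ≡ q * (r j * α j)
      *r*α j q = sym (trans (cong (q *_) (r*α j)) (ℚP.*-identityʳ q))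

      x : Fin k → ℚ
      x j = (β j - α j) * r j

      -- Dividing `d j` by `α j` gives `h j - T * x j`.
      sum-rate : T * sum x + sum (λ j → d j * r j) ≡ sum h
      sum-rate = trans (cong (T * sum x +_) (sum-cong-≗ rate′)) (go h x)
        where
        rate′ : ∀ j → d j * r j ≡ h j - T * x j
        rate′ j = trans (rate (α j) (h j) T (β j - α j) (r j))
          (cong (_- T * x j) (trans (cong (_* h j) (r*α j)) (ℚP.*-identityˡ (h j))))
        go : ∀ {k} (h x : Fin k → ℚ) → T * sum x + sum (λ j → h j - T * x j) ≡ sum h
        go {zero}  h x = rate-base T
        go {suc k} h x = trans
          (rate-sum T (x zero) (sum (x ∘ suc)) (h zero) (sum λ j → h (suc j) - T * x (suc j)))
          (cong (h zero +_) (go (h ∘ suc) (x ∘ suc)))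

      -- `sum-rate` gives `T * sum x ≤ sum h`, which telescopes to at most `B`; moreover
      -- `β j = α j * (1 + x j)`.
      final-bound : 0ℚ ≤ sum (λ j → d j * r j) → Bound α β
      final-bound 0≤S = tabulate x
        , AllP.tabulate⁺ (λ j → nonNeg* (diff≤ (ordered F j)) (0≤r j))
        , ℚP.≤-trans (ℚP.≤-reflexive (cong (T *_) (ΣL-tabulate x)))
            (ℚP.≤-trans (undiff≤ 0≤S sum-rate)
              (subst (sum h ≤_) (ℚP.+-identityʳ B) (telescope 0≤B (bounded F))))
        , ℚP.≤-reflexive (product-factor λ j → sym (trans (sym (ratio (α j) (β j - α j) (r j)))
            (trans (cong (α j +_) (sym (*r*α j (β j - α j)))) (add-diff (α j) (β j)))))

      -- The new left ends are `α j * (1 + e j)` with total excess at most 0, so by AM-GM their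
      -- product does not grow.
      shift-bound : ∀ {t} → 0ℚ ≤ t → (∀ j → 0ℚ ≤ α j + t * d j) →
                    sum (λ j → d j * r j) ≤ 0ℚ →
                    Bound (λ j → α j + t * d j) β → Bound α β
      shift-bound {t} 0≤t 0≤α′ S≤0 = bound-mono α (λ j → α j + t * d j) β (begin
        product (λ j → α j + t * d j)     ≡⟨ product-factor factor ⟩
        product α * Π1+ (tabulate e)      ≤⟨ ℚP.*-monoˡ-≤-nonNeg (product α)
                                               ⦃ ℚ.nonNegative (product-nonNeg (ℚP.<⇒≤ ∘ 0<α)) ⦄
                                               (am-gm (AllP.tabulate⁺ -1≤e) Σe≤0) ⟩
        product α * 1ℚ                    ≡⟨ ℚP.*-identityʳ (product α) ⟩
        product α                         ∎)
        where
        open ℚP.≤-Reasoning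
        e : Fin k → ℚ
        e j = t * (d j * r j)
        factor : ∀ j → α j + t * d j ≡ α j * (1ℚ + e j)
        factor j = trans (cong (λ q → α j + t * q) (*r*α j (d j))) (ratio-shift (α j) t (d j) (r j))
        -1≤e : ∀ j → - 1ℚ ≤ e j
        -1≤e j = undiff≤ (subst (0ℚ ≤_)
            (trans (shift-ratio (α j) t (d j) (r j)) (cong (_+ e j) (r*α j)))
            (nonNeg* (0≤α′ j) (0≤r j)))
          (neg-one-plus (e j))
        Σe≤0 : ΣL (tabulate e) ≤ 0ℚ
        Σe≤0 = subst₂ _≤_ (sym (trans (ΣL-tabulate e) (sum-* t λ j → d j * r j))) (ℚP.*-zeroʳ t)
          (ℚP.*-monoˡ-≤-nonNeg t ⦃ ℚ.nonNegative 0≤t ⦄ S≤0)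

    -- Either the present ratios already satisfy the bound, or the flow runs until the next event,
    -- which removes an interval.
    bound : ∀ {k} {α β : Fin k → ℚ} → Family α β → Bound α β
    bound {zero} F = [] , [] , subst (_≤ B) (sym (ℚP.*-zeroʳ T)) 0≤B , ℚP.≤-refl
    bound {suc k} {α} {β} F
      with FinP.any? (λ j → (α j ℚP.≟ prev 0ℚ β j) ⊎-dec (α j ℚP.≟ β j))
    ... | yes event = reduce bound F event
    ... | no  none = go (0ℚ ℚP.≤? sum λ j → d j * r j)
      where
      open Flow F
      p<α : ∀ j → p j < α j
      p<α j = ≤∧≢⇒<ℚ (p≤α j) λ eq → none (j , inj₁ (sym eq))
      α<β : ∀ j → α j < β j
      α<β j = ≤∧≢⇒<ℚ (ordered F j) λ eq → none (j , inj₂ eq)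
      open Strict F (λ j → ℚP.≤-<-trans (p-nonNeg j) (p<α j))
      go : Dec (0ℚ ≤ sum λ j → d j * r j) → Bound α β
      go (yes 0≤S) = final-bound 0≤S
      go (no  0≰S) with exit p α β d p<α α<β
      -- If all velocities vanished, the sum of the `d j * r j` would be 0, but it is negative here.
      ... | inj₁ d≡0 = ⊥-elim (0≰S (ℚP.≤-reflexive (sym (trans
        (sum-cong-≗ λ j → cong (_* r j) (d≡0 j))
        (trans (sum-* 0ℚ r) (ℚP.*-zeroˡ (sum r)))))))
      ... | inj₂ (t , 0≤t , inside , event) = shift-bound 0≤t α′-nonNeg (ℚP.<⇒≤ (ℚP.≰⇒> 0≰S))
        (reduce bound shifted-family event)
        where
        open Shifted 0≤t (λ j → proj₁ (inside j t 0≤t ℚP.≤-refl))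
          (λ j → proj₂ (inside j t 0≤t ℚP.≤-refl))

  -- Reciprocals and the converse of AM-GM.

  -- With `x = 1/a` and `y = 1/b`, the difference `x - y` equals `x * y * (b - a)`.
  inverse-antimono : ∀ {a b x y} → 0ℚ ≤ x → 0ℚ ≤ y → x * a ≡ 1ℚ → y * b ≡ 1ℚ → a ≤ b → y ≤ x
  inverse-antimono {a} {b} {x} {y} 0≤x 0≤y xa≡1 yb≡1 a≤b = undiff≤
    (nonNeg* (nonNeg* 0≤x 0≤y) (diff≤ a≤b))
    (trans (inverse-diff a b x y) (trans
      (cong₂ (λ p q → y + (x * p - y * q)) yb≡1 xa≡1) (inverse-end x y)))

  inverse-nonNeg : ∀ {a x} → 0ℚ < a → x * a ≡ 1ℚ → 0ℚ ≤ x
  inverse-nonNeg {a} {x} 0<a xa≡1 = ℚP.<⇒≤ (pos-factor 0<a (subst (0ℚ <_) (sym xa≡1) 0<1))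

  product-pos : ∀ {k} {v : Fin k → ℚ} → (∀ j → 0ℚ < v j) → 0ℚ < product v
  product-pos {zero}  h = 0<1
  product-pos {suc k} h = pos* (h zero) (product-pos (h ∘ suc))

  ΣL-++ : ∀ es fs → ΣL (es ++ fs) ≡ ΣL es + ΣL fs
  ΣL-++ []       fs = sym (ℚP.+-identityˡ (ΣL fs))
  ΣL-++ (e ∷ es) fs = trans (cong (e +_) (ΣL-++ es fs)) (sym (ℚP.+-assoc e (ΣL es) (ΣL fs)))

  Π1+-++ : ∀ es fs → Π1+ (es ++ fs) ≡ Π1+ es * Π1+ fs
  Π1+-++ []       fs = sym (ℚP.*-identityˡ (Π1+ fs))
  Π1+-++ (e ∷ es) fs = trans (cong ((1ℚ + e) *_) (Π1+-++ es fs))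
    (sym (ℚP.*-assoc (1ℚ + e) (Π1+ es) (Π1+ fs)))

  -- If the sum were negative, adjoining its negative as one more excess would make the total 0 and
  -- the product larger than 1.
  am-gm-converse : ∀ {es} → All (- 1ℚ ≤_) es → 1ℚ ≤ Π1+ es → 0ℚ ≤ ΣL es
  am-gm-converse {es} hs 1≤Π = ℚP.≮⇒≥ λ Σ<0 → let 0<g = ℚP.neg-antimono-< Σ<0 in
    ℚP.<-irrefl refl (begin-strict
      1ℚ                          <⟨ undiff 0<g refl ⟩
      1ℚ + - ΣL es                ≡⟨ sym (ℚP.*-identityʳ (1ℚ + - ΣL es)) ⟩
      (1ℚ + - ΣL es) * 1ℚ         ≤⟨ ℚP.*-monoˡ-≤-nonNeg (1ℚ + - ΣL es)
                                       ⦃ ℚ.nonNegative (ℚP.+-mono-≤ 0≤1 (ℚP.<⇒≤ 0<g)) ⦄ 1≤Π ⟩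
      (1ℚ + - ΣL es) * Π1+ es     ≤⟨ am-gm (ℚP.≤-trans -1≤0 (ℚP.<⇒≤ 0<g) ∷ hs)
                                       (ℚP.≤-reflexive (ℚP.+-inverseˡ (ΣL es))) ⟩
      1ℚ                          ∎)
    where open ℚP.≤-Reasoning

  -- Bounded search and natural numbers as rationals.

  -- There are finitely many lists of length at most `m`; `go` runs through the possible heads. This
  -- makes the existence claim constructive.
  search : ∀ {k} m {P : List (Fin k) → Set} → (∀ n → Dec (P n)) →
           ∃ P ⊎ (∀ n → length n ℕ.≤ m → ¬ P n)
  search m P? with P? []
  search m P? | yes p = inj₁ ([] , p)
  search zero P? | no ¬p = inj₂ λ { [] _ → ¬p }
  search {k} (suc m) {P} P? | no ¬p with go k (λ i → i)
    where
    go : ∀ l → (f : Fin l → Fin k) → ∃ P ⊎ (∀ i n → length n ℕ.≤ m → ¬ P (f i ∷ n))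
    go zero    f = inj₂ λ ()
    go (suc l) f with search m (λ n → P? (f zero ∷ n)) | go l (f ∘ suc)
    ... | inj₁ (n , p) | _      = inj₁ (f zero ∷ n , p)
    ... | inj₂ _       | inj₁ p = inj₁ p
    ... | inj₂ h       | inj₂ hs = inj₂ λ { zero → h ; (suc i) → hs i }
  ... | inj₁ p = inj₁ p
  ... | inj₂ h = inj₂ λ { [] _ → ¬p ; (i ∷ n) (ℕ.s≤s le) → h i n le }

  fromNat : ℕ → ℚ
  fromNat n = ℤ.+ n ℚ./ 1

  fromNat-nonNeg : ∀ n → 0ℚ ≤ fromNat n
  fromNat-nonNeg zero    = ℚP.≤-refl
  fromNat-nonNeg (suc n) = subst (0ℚ ≤_) (sym (suc/1 n)) (ℚP.+-mono-≤ 0≤1 (fromNat-nonNeg n))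

  fromNat-mono : ∀ {m n} → m ℕ.≤ n → fromNat m ≤ fromNat n
  fromNat-mono {n = n} ℕ.z≤n = fromNat-nonNeg n
  fromNat-mono {suc m} {suc n} (ℕ.s≤s le) = subst₂ _≤_ (sym (suc/1 m)) (sym (suc/1 n))
    (ℚP.+-monoʳ-≤ 1ℚ (fromNat-mono le))

  fromNat-< : ∀ m → fromNat m < fromNat (suc m)
  fromNat-< m = undiff 0<1 (trans (ℚP.+-comm (fromNat m) 1ℚ) (sym (suc/1 m)))

  length≤∙ : ∀ {k} {v : Fin k → ℚ} → (∀ j → 1ℚ ≤ v j) → ∀ {m} n → m ℕ.≤ length n → fromNat m ≤ n ∙ v
  length≤∙ h {zero} n _ = ∙-nonNeg (λ j → ℚP.≤-trans 0≤1 (h j)) n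
  length≤∙ {v = v} h {suc m} (j ∷ n) (ℕ.s≤s le) = subst (_≤ v j + n ∙ v) (sym (suc/1 m))
    (ℚP.+-mono-≤ (h j) (length≤∙ h n le))

  -- Unit intervals at integers.

  -- The integers val j stand for the intervals (val j , val j + 1).  Their left
  -- ends are moved up by ε, which makes up for N being known only to lie between
  -- N⁻ and N⁺.
  module UnitIntervals {k} (val : Fin k → ℕ) {N⁻ N⁺ ε : ℚ}
    (1≤val : ∀ j → 1 ℕ.≤ val j) (increasing : ∀ i j → toℕ i ℕ.< toℕ j → val i ℕ.< val j)
    (0<ε : 0ℚ < ε) (ε≤1 : ε ≤ 1ℚ) (0<N⁺ : 0ℚ < N⁺) (N⁺≤N⁻+ε : N⁺ ≤ N⁻ + ε) where

    a b : Fin k → ℚ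
    a j = fromNat (val j)
    b j = a j + 1ℚ

    -- `n ∙ b` exceeds `n ∙ a` by the length of `n`, so for `N` between `N⁻` and `N⁺` a hit is a sum
    -- of the required kind.
    Hit : List (Fin k) → Set
    Hit n = n ∙ a ≤ N⁻ × N⁺ ≤ n ∙ b

    1≤a : ∀ j → 1ℚ ≤ a j
    1≤a j = fromNat-mono (1≤val j)

    0≤a : ∀ j → 0ℚ ≤ a j
    0≤a j = ℚP.≤-trans 0≤1 (1≤a j)

    0<a : ∀ j → 0ℚ < a j
    0<a j = ℚP.<-≤-trans 0<1 (1≤a j)

    0<b : ∀ j → 0ℚ < b j
    0<b j = ℚP.+-mono-<-≤ (0<a j) 0≤1

    a≤b : ∀ j → a j ≤ b j
    a≤b j = undiff≤ {a j} 0≤1 refl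

    b≤a : ∀ i j → toℕ i ℕ.< toℕ j → b i ≤ a j
    b≤a i j i<j = subst (_≤ a j) (trans (suc/1 (val i)) (ℚP.+-comm 1ℚ (a i)))
      (fromNat-mono (increasing i j i<j))

    -- As every `a j` is at least 1, a list longer than `m ≥ N⁻` has a total above `N⁻`, so a
    -- bounded search decides.
    hit-or-miss : ∃ Hit ⊎ (∀ n → N⁻ < n ∙ a ⊎ n ∙ b < N⁺)
    hit-or-miss =
      let m , N⁻≤m = ≤-numerator N⁻ in
      case search m (λ n → (n ∙ a ℚP.≤? N⁻) ×-dec (N⁺ ℚP.≤? n ∙ b)) of λ
        { (inj₁ hit)  → inj₁ hit
        ; (inj₂ miss) → inj₂ λ n → case n ∙ a ℚP.≤? N⁻ of λ
          { (no ≰)    → inj₁ (ℚP.≰⇒> ≰)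
          ; (yes ≤N⁻) → case length n ℕP.≤? m of λ
            { (yes le) → inj₂ (ℚP.≰⇒> λ N⁺≤ → miss n le (≤N⁻ , N⁺≤))
            ; (no ≰)   → inj₁ (ℚP.≤-<-trans N⁻≤m (ℚP.<-≤-trans (fromNat-< m)
                (length≤∙ 1≤a n (ℕP.≰⇒> ≰))))
            }
          }
        }

    module _ (miss : ∀ n → N⁻ < n ∙ a ⊎ n ∙ b < N⁺) where

      -- Once K ≥ a + 1, K a ≤ N⁻ gives K (a + 1) < N⁺ and hence (K + 1) a ≤ N⁻.
      N⁻<b*b : ∀ j → N⁻ < b j * b j
      N⁻<b*b j = ℚP.≰⇒> λ b²≤N⁻ → case archimedean (N⁻ + 1ℚ) (0<a j) of λ
        { (m , N⁻+1≤) → ℚP.<-irrefl refl (begin-strict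
            N⁻                                      <⟨ undiff 0<1 refl ⟩
            N⁻ + 1ℚ                                 ≤⟨ N⁻+1≤ ⟩
            multiple m (a j)                        ≡⟨ multiple-* m (a j) ⟩
            fromNat m * a j                         ≤⟨ ℚP.*-monoʳ-≤-nonNeg (a j)
                                                         ⦃ ℚ.nonNegative (0≤a j) ⦄
                                                         (fromNat-mono (ℕP.m≤m+n m (suc (val j)))) ⟩
            fromNat (m ℕ.+ suc (val j)) * a j       ≤⟨ small-multiples b²≤N⁻ m ⟩
            N⁻                                      ∎)
        }
        where
        open ℚP.≤-Reasoning
        small-multiples : b j * b j ≤ N⁻ → ∀ m → fromNat (m ℕ.+ suc (val j)) * a j ≤ N⁻
        small-multiples b²≤N⁻ zero = begin
          fromNat (suc (val j)) * a j     ≡⟨ cong (_* a j) (suc/1 (val j)) ⟩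
          (1ℚ + a j) * a j                ≤⟨ undiff≤ (ℚP.+-mono-≤ 0≤1 (0≤a j)) (square (a j)) ⟩
          b j * b j                       ≤⟨ b²≤N⁻ ⟩
          N⁻                              ∎
        small-multiples b²≤N⁻ (suc m) = case miss (replicate K j) of λ
          { (inj₁ N⁻<) → ⊥-elim (ℚP.<-irrefl refl (ℚP.<-≤-trans N⁻<
              (subst (_≤ N⁻) (sym (∙-replicate a K j)) (small-multiples b²≤N⁻ m))))
          ; (inj₂ <N⁺) → subst (λ q → q * a j ≤ N⁻) (sym (suc/1 K)) (undiff≤
              (ℚP.+-mono-≤
                (diff≤ (ℚP.≤-trans (subst (_≤ N⁺) (∙-replicate b K j) (ℚP.<⇒≤ <N⁺))
                  (ℚP.≤-trans N⁺≤N⁻+ε (ℚP.+-monoʳ-≤ N⁻ ε≤1))))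
                (diff≤ (subst (_≤ fromNat K) (suc/1 (val j))
                  (fromNat-mono (ℕP.m≤n+m (suc (val j)) m)))))
              (multiples-step (a j) (fromNat K) N⁻))
          }
          where
          K : ℕ
          K = m ℕ.+ suc (val j)

      b<N⁺ : (∀ j → a j ≤ N⁻) → ∀ j → b j < N⁺
      b<N⁺ a≤N⁻ j = case miss (j ∷ []) of λ
        { (inj₁ N⁻<a) → ⊥-elim (ℚP.<-irrefl refl (ℚP.<-≤-trans N⁻<a
            (subst (_≤ N⁻) (sym (ℚP.+-identityʳ (a j))) (a≤N⁻ j))))
        ; (inj₂ lt)   → subst (_< N⁺) (ℚP.+-identityʳ (b j)) lt
        }

      module _ {B} (a≤N⁻ : ∀ j → a j ≤ N⁻) (b≤B : ∀ j → b j ≤ B) (0≤B : 0ℚ ≤ B) where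
        open Families N⁺ B 0<N⁺ 0≤B

        α : Fin k → ℚ
        α j = a j + ε

        a≤α : ∀ j → a j ≤ α j
        a≤α j = undiff≤ {a j} (ℚP.<⇒≤ 0<ε) refl

        family : Family α b
        family = record
          { nonNeg    = λ j → ℚP.≤-trans (0≤a j) (a≤α j)
          ; ordered   = λ j → ℚP.+-monoʳ-≤ (a j) ε≤1
          ; below     = b<N⁺ a≤N⁻
          ; bounded   = b≤B
          ; separated = λ i j i<j → ℚP.≤-trans (b≤a i j i<j) (a≤α j)
          ; avoids    = avoid
          }
          where
          open ℚP.≤-Reasoning
          avoid : ∀ n → N⁺ ≤ n ∙ α ⊎ n ∙ b ≤ N⁺
          avoid []      = inj₂ (ℚP.<⇒≤ 0<N⁺)
          avoid (j ∷ n) = case miss (j ∷ n) of λ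
            { (inj₂ <N⁺) → inj₂ (ℚP.<⇒≤ <N⁺)
            -- A nonempty sum contains at least one `ε`, which bridges the gap from `N⁻` to `N⁺`.
            ; (inj₁ N⁻<) → inj₁ (begin
                N⁺                      ≤⟨ N⁺≤N⁻+ε ⟩
                N⁻ + ε                  ≤⟨ ℚP.+-monoˡ-≤ ε (ℚP.<⇒≤ N⁻<) ⟩
                (a j + n ∙ a) + ε       ≡⟨ ℚP.+-assoc (a j) (n ∙ a) ε ⟩
                a j + (n ∙ a + ε)       ≡⟨ cong (a j +_) (ℚP.+-comm (n ∙ a) ε) ⟩
                a j + (ε + n ∙ a)       ≡⟨ sym (ℚP.+-assoc (a j) ε (n ∙ a)) ⟩
                (a j + ε) + n ∙ a       ≤⟨ ℚP.+-monoʳ-≤ (α j) (∙-mono (All.universal a≤α n)) ⟩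
                (a j + ε) + n ∙ α       ∎)
            }

        module _ {i : Fin k → ℚ} (i*b : ∀ j → i j * b j ≡ 1ℚ) where
          z : Fin k → ℚ
          z j = (1ℚ - ε) * i j

          -- As `α j = b j * (1 - z j)`, the bound for the family says that the factors `1 - z j`
          -- and `1 + e`, for `e` in `es`, have product at least 1. The converse of AM-GM gives
          -- `sum z ≤ ΣL es`.
          reciprocal-bound : N⁺ * sum z ≤ B
          reciprocal-bound with bound family
          ... | es , 0≤es , Σ≤B , Π≤ = ℚP.≤-trans
            (ℚP.*-monoˡ-≤-nonNeg N⁺ ⦃ ℚ.nonNegative (ℚP.<⇒≤ 0<N⁺) ⦄ Σz≤Σes) Σ≤B
            where
            -z : Fin k → ℚ
            -z j = - z j
            factor : ∀ j → α j ≡ b j * (1ℚ + -z j)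
            factor j = trans (left-end (a j) ε) (trans
              (cong (λ q → b j + - (1ℚ - ε) * q) (sym (i*b j))) (left-end′ (b j) ε (i j)))
            -1≤-z : ∀ j → - 1ℚ ≤ -z j
            -1≤-z j = undiff≤ {e = 1ℚ + -z j}
              (ℚP.<⇒≤ (pos-factor {1ℚ + -z j} (0<b j) (subst (0ℚ <_)
                (trans (factor j) (ℚP.*-comm (b j) (1ℚ + -z j)))
                (ℚP.<-≤-trans (0<a j) (a≤α j)))))
              (neg-one-plus (-z j))
            Πb≡ : product α ≡ product b * Π1+ (tabulate -z)
            Πb≡ = product-factor factor
            1≤Π : 1ℚ ≤ Π1+ (tabulate -z ++ es)
            1≤Π = ℚP.*-cancelˡ-≤-pos (product b) ⦃ ℚ.positive (product-pos 0<b) ⦄ (begin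
              product b * 1ℚ                               ≡⟨ ℚP.*-identityʳ (product b) ⟩
              product b                                    ≤⟨ Π≤ ⟩
              product α * Π1+ es                           ≡⟨ cong (_* Π1+ es) Πb≡ ⟩
              product b * Π1+ (tabulate -z) * Π1+ es       ≡⟨ ℚP.*-assoc (product b) (Π1+ (tabulate -z)) _ ⟩
              product b * (Π1+ (tabulate -z) * Π1+ es)     ≡⟨ cong (product b *_)
                                                              (sym (Π1+-++ (tabulate -z) es)) ⟩
              product b * Π1+ (tabulate -z ++ es)          ∎)
              where open ℚP.≤-Reasoning
            sum-neg : ∀ {k} (v : Fin k → ℚ) → sum v + sum (λ j → - v j) ≡ 0ℚ
            sum-neg {zero}  v = refl
            sum-neg {suc k} v = trans
              (+-interchange (v zero) (sum (v ∘ suc)) (- v zero) (sum λ j → - v (suc j)))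
              (trans (cong₂ _+_ (ℚP.+-inverseʳ (v zero)) (sum-neg (v ∘ suc))) (ℚP.+-identityˡ 0ℚ))
            Σz≤Σes : sum z ≤ ΣL es
            Σz≤Σes = undiff≤
              (am-gm-converse (AllP.++⁺ (AllP.tabulate⁺ -1≤-z)
                (All.map (ℚP.≤-trans -1≤0) 0≤es)) 1≤Π)
              (trans (cong (sum z +_)
                  (trans (ΣL-++ (tabulate -z) es) (cong (_+ ΣL es) (ΣL-tabulate -z))))
                (trans (sym (ℚP.+-assoc (sum z) (sum -z) (ΣL es)))
                  (trans (cong (_+ ΣL es) (sum-neg z)) (ℚP.+-identityˡ (ΣL es)))))

  -- Contradiction from the absence of hits.

  square-cancel-< : ∀ {x y} → 0ℚ ≤ x → 0ℚ ≤ y → x * x < y * y → x < y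
  square-cancel-< {x} {y} 0≤x 0≤y x²<y² = ℚP.≰⇒> λ y≤x → ℚP.<-irrefl refl (ℚP.<-≤-trans x²<y²
    (undiff≤ (nonNeg* (diff≤ y≤x) (ℚP.+-mono-≤ 0≤y 0≤x)) (square-diff y x)))

  module _ {k} (j₀ : Fin k) (val : Fin k → ℕ) {N⁻ N⁺ ε : ℚ}
    (1≤val : ∀ j → 1 ℕ.≤ val j) (increasing : ∀ i j → toℕ i ℕ.< toℕ j → val i ℕ.< val j)
    (0<ε : 0ℚ < ε) (ε≤1 : ε ≤ 1ℚ) (0<N⁺ : 0ℚ < N⁺) (N⁺≤N⁻+ε : N⁺ ≤ N⁻ + ε) where
    open UnitIntervals val {N⁻} {N⁺} {ε} 1≤val increasing 0<ε ε≤1 0<N⁺ N⁺≤N⁻+ε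

    -- In the application `q₁` and `q₂` exceed `1/u` and `1/(√N - 1)`, and `r` lies below `√N - 1`;
    -- `w₁` and `w₂` are the reciprocals of `r` and `B`. The upper bound for `sum ib` from
    -- `reciprocal-bound` clashes with the lower bound from telescoping.
    total-miss-absurd : ∀ {B M r q₁ q₂ w₁ w₂} {ia ib : Fin k → ℚ} →
      (∀ n → N⁻ < n ∙ a ⊎ n ∙ b < N⁺) → (∀ j → a j ≤ N⁻) →
      (∀ j → b j ≤ B) → B ≤ M + 1ℚ → B ≤ N⁺ → 0ℚ < r → (r + 1ℚ) * (r + 1ℚ) ≤ N⁻ →
      (∀ j → ia j * a j ≡ 1ℚ) → (∀ j → ib j * b j ≡ 1ℚ) → w₁ * r ≡ 1ℚ → w₂ * B ≡ 1ℚ →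
      M ≤ q₁ * N⁺ → 1ℚ < q₂ * r → ε * sum ia ≤ sum ia - (q₁ + q₂) → ⊥
    total-miss-absurd {B} {M} {r} {q₁} {q₂} {w₁} {w₂} {ia} {ib}
      miss a≤N⁻ b≤B B≤M+1 B≤N⁺ 0<r r²≤N⁻ ia*a ib*b w₁r≡1 w₂B≡1 M≤ 1<q₂r εI≤ =
      ℚP.<-irrefl refl (begin-strict
        N⁺ * sum (λ j → (1ℚ - ε) * ib j)     ≤⟨ reciprocal-bound miss {B} a≤N⁻ b≤B
                                                (ℚP.<⇒≤ 0<B) {ib} ib*b ⟩
        B                                    ≤⟨ B≤M+1 ⟩
        M + 1ℚ                               ≤⟨ ℚP.+-mono-≤ M≤ 1≤w₂N⁺ ⟩
        q₁ * N⁺ + w₂ * N⁺                    ≡⟨ sym (ℚP.*-distribʳ-+ N⁺ q₁ w₂) ⟩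
        (q₁ + w₂) * N⁺                       <⟨ *c-mono 0<N⁺ q₁+w₂< ⟩
        (1ℚ - ε) * sum ib * N⁺               ≡⟨ ℚP.*-comm ((1ℚ - ε) * sum ib) N⁺ ⟩
        N⁺ * ((1ℚ - ε) * sum ib)             ≡⟨ cong (N⁺ *_) (sym (sum-* (1ℚ - ε) ib)) ⟩
        N⁺ * sum (λ j → (1ℚ - ε) * ib j)     ∎)
      where
      open ℚP.≤-Reasoning
      0<B : 0ℚ < B
      0<B = ℚP.<-≤-trans (0<b j₀) (b≤B j₀)
      0≤ia : ∀ j → 0ℚ ≤ ia j
      0≤ia j = inverse-nonNeg (0<a j) (ia*a j)
      0≤ib : ∀ j → 0ℚ ≤ ib j
      0≤ib j = inverse-nonNeg (0<b j) (ib*b j)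
      0≤w₁ : 0ℚ ≤ w₁
      0≤w₁ = inverse-nonNeg 0<r w₁r≡1
      0≤w₂ : 0ℚ ≤ w₂
      0≤w₂ = inverse-nonNeg 0<B w₂B≡1
      1≤w₂N⁺ : 1ℚ ≤ w₂ * N⁺
      1≤w₂N⁺ = subst (_≤ w₂ * N⁺) w₂B≡1
        (ℚP.*-monoˡ-≤-nonNeg w₂ ⦃ ℚ.nonNegative 0≤w₂ ⦄ B≤N⁺)
      w₁<q₂ : w₁ < q₂
      w₁<q₂ = ℚP.*-cancelʳ-<-nonNeg r ⦃ ℚ.nonNegative (ℚP.<⇒≤ 0<r) ⦄
        (subst (_< q₂ * r) (sym w₁r≡1) 1<q₂r)
      r≤a : ∀ j → r ≤ a j
      r≤a j = ℚP.≮⇒≥ λ a<r → ℚP.<-asym (ℚP.+-monoˡ-< 1ℚ a<r)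
        (square-cancel-< (ℚP.+-mono-≤ (ℚP.<⇒≤ 0<r) 0≤1) (ℚP.<⇒≤ (0<b j))
          (ℚP.≤-<-trans r²≤N⁻ (N⁻<b*b miss j)))
      -ib : Fin k → ℚ
      -ib j = - ib j
      -- The preceding right end, or `r` for the first index, is at most `a j`. Reciprocals are
      -- negated to fit `telescope`, which expects a common upper bound.
      ia≤ : ∀ j → ia j ≤ - prev (- w₁) -ib j
      ia≤ j with prev-cases (- w₁) -ib j
      ... | inj₁ eq = subst (ia j ≤_) (trans (eq9 w₁) (cong -_ (sym eq)))
        (inverse-antimono 0≤w₁ (0≤ia j) w₁r≡1 (ia*a j) (r≤a j))
      ... | inj₂ (i , j≡1+i , eq) = subst (ia j ≤_) (trans (eq9 (ib i)) (cong -_ (sym eq)))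
        (inverse-antimono (0≤ib i) (0≤ia j) (ib*b i) (ia*a j)
          (b≤a i j (ℕP.≤-reflexive (sym j≡1+i))))
      w₂≤ib : ∀ j → w₂ ≤ ib j
      w₂≤ib j = inverse-antimono (0≤ib j) 0≤w₂ (ib*b j) w₂B≡1 (b≤B j)
      w₂≤w₁ : w₂ ≤ w₁
      w₂≤w₁ = inverse-antimono 0≤w₁ 0≤w₂ w₁r≡1 w₂B≡1
        (ℚP.≤-trans (r≤a j₀) (ℚP.≤-trans (a≤b j₀) (b≤B j₀)))
      -- ∑ (1/a − 1/(a+1)) ≤ 1/r − 1/B, since the intervals (a , a + 1) are disjoint
      -- and lie between r and B.
      I≤ : sum ia ≤ (- w₂ - - w₁) + sum ib
      I≤ = begin
        sum ia                                            ≡⟨ sum-cong-≗ (λ j → sym (eq3 (ia j) (ib j))) ⟩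
        sum (λ j → (ia j - ib j) + ib j)                  ≡⟨ ∑-distrib-+ (λ j → ia j - ib j) ib ⟩
        sum (λ j → ia j - ib j) + sum ib                  ≤⟨ ℚP.+-monoˡ-≤ (sum ib) (sum-mono ia-ib≤) ⟩
        sum (λ j → -ib j - prev (- w₁) -ib j) + sum ib    ≤⟨ ℚP.+-monoˡ-≤ (sum ib) Σ≤ ⟩
        (- w₂ - - w₁) + sum ib                            ∎
        where
        ia-ib≤ : ∀ j → ia j - ib j ≤ -ib j - prev (- w₁) -ib j
        ia-ib≤ j = undiff≤ (diff≤ (ia≤ j)) (sub-mono (ia j) (ib j) (prev (- w₁) -ib j))
        Σ≤ : sum (λ j → -ib j - prev (- w₁) -ib j) ≤ - w₂ - - w₁
        Σ≤ = telescope (ℚP.neg-antimono-≤ w₂≤w₁) (ℚP.neg-antimono-≤ ∘ w₂≤ib)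
      J≤I : sum ib ≤ sum ia
      J≤I = sum-mono λ j → inverse-antimono (0≤ia j) (0≤ib j) (ia*a j) (ib*b j) (a≤b j)
      -- With `I = sum ia` and `J = sum ib`: `(1 - ε) J ≥ J - ε I ≥ I - w₁ + w₂ - ε I ≥ q₁ + q₂ - w₁
      -- + w₂ > q₁ + w₂`.
      q₁+w₂< : q₁ + w₂ < (1ℚ - ε) * sum ib
      q₁+w₂< = undiff
        (ℚP.+-mono-≤-< (ℚP.+-mono-≤ (ℚP.+-mono-≤ (diff≤ I≤) (diff≤ εI≤))
          (nonNeg* (ℚP.<⇒≤ 0<ε) (diff≤ J≤I))) (diff w₁<q₂))
        (slack q₁ q₂ w₁ w₂ ε (sum ia) (sum ib))

    hit : ∀ {M r q₁ q₂} {ia : Fin k → ℚ} → (∀ j → ia j * a j ≡ 1ℚ) →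
          0ℚ < r → (r + 1ℚ) * (r + 1ℚ) ≤ N⁻ → (∀ j → a j ≤ M) → (∀ j → a j ≤ N⁻) →
          M ≤ q₁ * N⁺ → 1ℚ < q₂ * r → ε * sum ia ≤ sum ia - (q₁ + q₂) → ∃ Hit
    hit {M} {r} {q₁} {q₂} {ia} ia*a 0<r r²≤N⁻ a≤M a≤N⁻ M≤ 1<q₂r εI≤ = case hit-or-miss of λ
      { (inj₁ found) → found
      -- `B` is the smaller of `M + 1` and `N⁺`: both `B ≤ M + 1` and `1 ≤ w₂ * N⁺` are required.
      ; (inj₂ miss)  → ⊥-elim (case ℚP.≤-total (M + 1ℚ) N⁺ of λ
        { (inj₁ M+1≤N⁺) → absurd miss (M + 1ℚ) (λ j → ℚP.+-monoˡ-≤ 1ℚ (a≤M j)) ℚP.≤-refl M+1≤N⁺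
        ; (inj₂ N⁺≤M+1) → absurd miss N⁺ (ℚP.<⇒≤ ∘ b<N⁺ miss a≤N⁻) N⁺≤M+1 ℚP.≤-refl
        })
      }
      where
      1/b : ∀ j → ∃ λ t → t * b j ≡ 1ℚ
      1/b j = quotient 1ℚ (0<b j)
      1/r : ∃ λ t → t * r ≡ 1ℚ
      1/r = quotient 1ℚ 0<r
      absurd : (∀ n → N⁻ < n ∙ a ⊎ n ∙ b < N⁺) →
               ∀ B → (∀ j → b j ≤ B) → B ≤ M + 1ℚ → B ≤ N⁺ → ⊥
      absurd miss B b≤B B≤M+1 B≤N⁺ =
        let w₂ , w₂B≡1 = quotient 1ℚ (ℚP.<-≤-trans (0<b j₀) (b≤B j₀)) in
        total-miss-absurd {B} {M} {r} {q₁} {q₂} {proj₁ 1/r} {w₂} {ia} {proj₁ ∘ 1/b}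
          miss a≤N⁻ b≤B B≤M+1 B≤N⁺ 0<r r²≤N⁻ ia*a (proj₂ ∘ 1/b) (proj₂ 1/r) w₂B≡1 M≤ 1<q₂r εI≤

-- Enumeration of the subset and translation of its sums.

open import Defs
open Lemmas hiding (lower)
open ℝ
open IntervalSums using (_∙_; fromNat; fromNat-nonNeg; fromNat-mono; hit)
module ℤ⟶ℚ = _-Raw-AlmostCommutative⟶_ ℤ⟶ℚ

-- The increasing order provides the separation of the unit intervals; the last clause turns `∑1/ A`
-- into a sum over the enumeration.
enumerate : ∀ {M} (A : Subset M) → ∃ λ k → ∃ λ (f : Fin k → Fin M) →
  (∀ j → f j ∈ A) × (∀ i j → toℕ i ℕ.< toℕ j → toℕ (f i) ℕ.< toℕ (f j)) ×
  (∀ (v : Fin M → ℚ) → ℚΣ.sum (λ i → if Vec.lookup A i then v i else 0ℚ) ≡ ℚΣ.sum (v ∘ f))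
enumerate Vec.[] = 0 , (λ ()) , (λ ()) , (λ ()) , λ _ → refl
enumerate (false Vec.∷ A) =
  let k , f , f∈A , f-mono , f-sum = enumerate A in
  k , suc ∘ f , (λ j → Vec.there (f∈A j)) , (λ i j i<j → ℕ.s≤s (f-mono i j i<j))
  , λ v → trans (ℚP.+-identityˡ _) (f-sum (v ∘ suc))
enumerate (true Vec.∷ A) =
  let k , f , f∈A , f-mono , f-sum = enumerate A in
  suc k
  , (λ { zero → zero ; (suc j) → suc (f j) })
  , (λ { zero → Vec.here ; (suc j) → Vec.there (f∈A j) })
  , (λ { zero    (suc j) _           → ℕ.s≤s ℕ.z≤n
       ; (suc i) (suc j) (ℕ.s≤s i<j) → ℕ.s≤s (f-mono i j i<j) })
  , λ v → cong (v zero ℚ.+_) (f-sum (v ∘ suc))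

sum≡∙ : ∀ {k} (val : Fin k → ℕ) n → fromNat (ℕΣ.sum λ i → val (lookup n i)) ≡ n ∙ (fromNat ∘ val)
sum≡∙ val []      = refl
sum≡∙ val (j ∷ n) = trans
  (ℤ⟶ℚ.+-homo (ℤ.+ val j) (ℤ.+ ℕΣ.sum λ i → val (lookup n i)))
  (cong (fromNat (val j) ℚ.+_) (sum≡∙ val n))

∙-+1 : ∀ {k} (v : Fin k → ℚ) n → n ∙ (λ j → v j ℚ.+ 1ℚ) ≡ n ∙ v ℚ.+ fromNat (length n)
∙-+1 v []      = refl
∙-+1 v (j ∷ n) = trans (cong (v j ℚ.+ 1ℚ ℚ.+_) (∙-+1 v n))
  (trans (+-interchange (v j) 1ℚ (n ∙ v) (fromNat (length n)))
    (cong (v j ℚ.+ n ∙ v ℚ.+_) (sym (suc/1 (length n)))))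

reciprocal : ∀ n → (ℤ.+ 1 ℚ./ suc n) ℚ.* fromNat (suc n) ≡ 1ℚ
reciprocal n = ℚP.toℚᵘ-injective (ℚᵘP.≃-trans
  (ℚP.toℚᵘ-homo-* (ℤ.+ 1 ℚ./ suc n) (fromNat (suc n)))
  (ℚᵘP.≃-trans
    (ℚᵘP.*-cong (ℚP.toℚᵘ-fromℚᵘ (ℚᵘ.mkℚᵘ (ℤ.+ 1) n)) (/1-homo (ℤ.+ suc n)))
    (ℚᵘ.*≡* (ℤP.*-assoc (ℤ.+ 1) (ℤ.+ suc n) (ℤ.+ 1)))))

-- Supplies the index `j₀` required by `hit`: an empty sum is not positive.
index : ∀ {k} (v : Fin k → ℚ) → 0ℚ ℚ.< ℚΣ.sum v → Fin k
index {zero}  v 0<0 = ⊥-elim (ℚP.<-irrefl refl 0<0)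
index {suc k} v _   = zero

-- Rational bounds extracted from Dedekind cuts.

-- Openness of the upper cut gives `x < q` still above `N`, hence room for `x - L < p′ < p < S`.
-- Then `p` separates the two reals, with `p′ - x` as the upper bound for `- L`.
-fromℚ-< : ∀ N L S {q} → Upper N q → q ℚ.≤ S ℚ.+ L → N - fromℚ L < fromℚ S
-fromℚ-< N L S {q} uq q≤S+L =
  let x , x<q , ux = upper-open N uq
      x-L<S = subst (x ℚ.- L ℚ.<_) (add-sub S L)
        (ℚP.+-monoˡ-< (ℚ.- L) (ℚP.<-≤-trans x<q q≤S+L))
      p , x-L<p , p<S = ℚP.<-dense x-L<S
      p′ , x-L<p′ , p′<p = ℚP.<-dense x-L<p
      -L<p′-x = subst (ℚ._< p′ ℚ.- x) (sub-sub x L) (ℚP.+-monoˡ-< (ℚ.- x) x-L<p′)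
  in p
    , ( x , p′ ℚ.- x , ux
      , subst (ℚ.- (p′ ℚ.- x) ℚ.<_) (sym (eq9 L)) (ℚP.neg-antimono-< -L<p′-x)
      , subst (ℚ._< p) (sym (add-diff x p′)) p′<p)
    , p<S

upper-/ : ∀ x y 0<y q → Upper (x / y [ 0<y ]) q →
          ∃ λ a → ∃ λ c → Upper x a × 0ℚ ℚ.< c × Lower y c × a ℚ.< q ℚ.* c
upper-/ x y 0<y q (a , c , _ , ua , 0<c , lc , _ , lt , _) = a , c , ua , 0<c , lc , lt

lower-/ : ∀ x y 0<y q → Lower (x / y [ 0<y ]) q →
          ∃ λ a → ∃ λ d → Lower x a × Upper y d × q ℚ.* d ℚ.< a
lower-/ x y 0<y q (a , _ , d , la , _ , _ , ud , _ , lt) = a , d , la , ud , lt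

-- The witness is `r = s - 1` with `s` below the root; `0 < c` makes `s` positive and so rules out
-- the clause of `√` for negative rationals.
lower-√-1 : ∀ x {c} → 0ℚ ℚ.< c → Lower (√ x - 1ℝ) c →
            ∃ λ r → c ℚ.< r × Lower x ((r ℚ.+ 1ℚ) ℚ.* (r ℚ.+ 1ℚ))
lower-√-1 x {c} 0<c (s , t , ls , 1<-t , c<s+t) =
  s ℚ.- 1ℚ , c<r , subst (λ q → Lower x (q ℚ.* q)) (sym (eq7 s)) (case ls of λ
    { (inj₁ s<0) → ⊥-elim (ℚP.<-asym s<0 0<s)
    ; (inj₂ l)   → l
    })
  where
  c<r : c ℚ.< s ℚ.- 1ℚ
  c<r = ℚP.<-trans c<s+t (ℚP.+-monoʳ-< s
    (subst (ℚ._< ℚ.- 1ℚ) (sym (eq9 t)) (ℚP.neg-antimono-< 1<-t)))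
  0<s : 0ℚ ℚ.< s
  0<s = ℚP.<-trans (ℚP.<-trans 0<c c<r) (undiff 0<1 (eq7 s))

module _ (N u : ℝ) (1≤u : 1ℝ ≤ u) {m : ℚ}
  (m≤N/u : ∀ q → q ℚ.< m → Lower (N / u [ 1≤x⇒0<x u 1≤u ]) q) where

  -- For `q ≥ l > 1` an upper bound `d` of `u` is at least 1, so `q ≤ q * d < a` with `a` below `N`.
  -- Smaller `q` lie below `l`, which is below `N`.
  below-N : 1ℝ < N → ∀ q → q ℚ.< m → Lower N q
  below-N (l , 1<l , ll) q q<m =
    let _ , d , la , ud , qd<a = lower-/ N u (1≤x⇒0<x u 1≤u) q (m≤N/u q q<m) in
    case q ℚP.<? l of λ
      { (yes q<l) → lower-closed N q<l ll
      ; (no  q≮l) → lower-closed N (ℚP.≤-<-trans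
          (subst (ℚ._≤ q ℚ.* d) (ℚP.*-identityʳ q)
            (ℚP.*-monoˡ-≤-nonNeg q
              ⦃ ℚ.nonNegative (ℚP.≤-trans (ℚP.<⇒≤ (ℚP.<-trans 0<1 1<l)) (ℚP.≮⇒≥ q≮l)) ⦄
              (ℚP.≮⇒≥ λ d<1 → disjoint u (1≤u d d<1) ud)))
          qd<a) la
      }

  -- Otherwise some `q < m` has `N⁺ < q * c`, although `q * c < q * d < a < N⁺` with `d` above `u`
  -- and `a` below `N`.
  *c≤ : ∀ {c N⁺} → 0ℚ ℚ.< c → Lower u c → 0ℚ ℚ.< N⁺ → Upper N N⁺ → m ℚ.* c ℚ.≤ N⁺
  *c≤ {c} {N⁺} 0<c lc 0<N⁺ uN⁺ = ℚP.≮⇒≥ λ N⁺<mc →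
    let q , q<m , N⁺<qc = Lemmas.lower 0<c N⁺<mc
        _ , d , la , ud , qd<a = lower-/ N u (1≤x⇒0<x u 1≤u) q (m≤N/u q q<m)
        0<q = pos-factor {q} 0<c (ℚP.<-trans 0<N⁺ N⁺<qc)
    in ℚP.<-asym N⁺<qc (ℚP.<-trans
      (ℚP.*-monoʳ-<-pos q ⦃ ℚ.positive 0<q ⦄ (lower<upper u lc ud))
      (ℚP.<-trans qd<a (lower<upper N la uN⁺)))

-- Assembly of the solution.

module Solution (N : ℝ) {M} (A : Subset M) {k} (f : Fin k → Fin M) (f∈A : ∀ j → f j ∈ A)
  (f-mono : ∀ i j → toℕ i ℕ.< toℕ j → toℕ (f i) ℕ.< toℕ (f j))
  (M≤N : ∀ q → q ℚ.< fromNat M → Lower N q)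
  (0<N : ∀ {q} → Upper N q → 0ℚ ℚ.< q) where

  val : Fin k → ℕ
  val = value ∘ f

  a ia : Fin k → ℚ
  a  = fromNat ∘ val
  ia = λ j → ℤ.+ 1 ℚ./ val j

  Conclusion : Set
  Conclusion = ∃ λ (k : ℕ) → 1 ℕ.≤ k × (∃ λ (a : Fin k → Fin M) →
    (∀ i → a i ∈ A) ×
    N - fromℕ k < fromℕ (ℕΣ.sum λ i → value (a i)) ×
    fromℕ (ℕΣ.sum λ i → value (a i)) ≤ N)

  finish : ∀ {N⁺} → Upper N N⁺ → ∀ n → (∀ q → q ℚ.< n ∙ a → Lower N q) →
           N⁺ ℚ.≤ n ∙ (λ j → a j ℚ.+ 1ℚ) → Conclusion
  -- The list is nonempty, giving `1 ≤ k`, because the empty sum would force `N⁺ ≤ 0`.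
  finish uN⁺ [] _ N⁺≤0 = ⊥-elim (ℚP.<-irrefl refl (ℚP.<-≤-trans (0<N uN⁺) N⁺≤0))
  finish {N⁺} uN⁺ n@(_ ∷ _) n∙a≤N N⁺≤ = length n , ℕ.s≤s ℕ.z≤n , f ∘ lookup n , f∈A ∘ lookup n
    , -fromℚ-< N (fromNat (length n)) (fromNat (ℕΣ.sum λ i → val (lookup n i))) uN⁺
        (subst (N⁺ ℚ.≤_)
          (trans (∙-+1 a n) (cong (ℚ._+ fromNat (length n)) (sym (sum≡∙ val n)))) N⁺≤)
    , λ q q< → n∙a≤N q (subst (q ℚ.<_) (sum≡∙ val n) q<)

  a≤M : ∀ j → a j ℚ.≤ fromNat M
  a≤M j = fromNat-mono (FinP.toℕ<n (f j))

  -- `σ` is the slack in the hypothesis on the reciprocal sum `I`; `(I + σ) * ε < σ` yields both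
  -- `ε ≤ 1` and `ε * I ≤ σ`.
  conclude : ∀ {I σ r q₁ q₂ ε N⁻ N⁺} → I ≡ ℚΣ.sum ia → σ ≡ I ℚ.- (q₁ ℚ.+ q₂) →
             0ℚ ℚ.< I → 0ℚ ℚ.< σ → 0ℚ ℚ.< r → 1ℚ ℚ.< q₂ ℚ.* r → 0ℚ ℚ.< ε → (I ℚ.+ σ) ℚ.* ε ℚ.< σ →
             (r ℚ.+ 1ℚ) ℚ.* (r ℚ.+ 1ℚ) ℚ.≤ N⁻ → Lower N N⁻ → Upper N N⁺ → N⁺ ℚ.≤ N⁻ ℚ.+ ε →
             fromNat M ℚ.≤ q₁ ℚ.* N⁺ → Conclusion
  conclude {I} {σ} {r} {q₁} {q₂} {ε} {N⁻} {N⁺}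
    I≡ σ≡ 0<I 0<σ 0<r 1<q₂r 0<ε small-ε r²≤N⁻ lN⁻ uN⁺ N⁺≤ M≤q₁N⁺ =
    case FinP.any? (λ j → N⁻ ℚP.<? a j) of λ
      -- An element between `N⁻` and `N` is a solution by itself: `a j ≤ M ≤ N` and
      -- `a j + 1 ≥ N⁻ + ε ≥ N⁺`.
      { (yes (j , N⁻<aj)) → finish uN⁺ (j ∷ [])
          (λ q q<aj → M≤N q (ℚP.<-≤-trans q<aj
            (subst (ℚ._≤ fromNat M) (sym (ℚP.+-identityʳ (a j))) (a≤M j))))
          (ℚP.≤-trans N⁺≤ (subst (N⁻ ℚ.+ ε ℚ.≤_) (sym (ℚP.+-identityʳ (a j ℚ.+ 1ℚ)))
            (ℚP.+-mono-≤ (ℚP.<⇒≤ N⁻<aj) ε≤1)))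
      ; (no none) →
          let n , n∙a≤N⁻ , N⁺≤n∙b = hit (index ia (subst (0ℚ ℚ.<_) I≡ 0<I)) val {N⁻} {N⁺} {ε}
                (λ _ → ℕ.s≤s ℕ.z≤n) (λ i j i<j → ℕ.s≤s (f-mono i j i<j)) 0<ε ε≤1 (0<N uN⁺) N⁺≤
                {fromNat M} {r} {q₁} {q₂} {ia}
                (λ j → reciprocal (toℕ (f j))) 0<r r²≤N⁻ a≤M
                (λ j → ℚP.≮⇒≥ λ N⁻<aj → none (j , N⁻<aj)) M≤q₁N⁺ 1<q₂r
                (subst (λ x → ε ℚ.* x ℚ.≤ x ℚ.- (q₁ ℚ.+ q₂)) I≡ (subst (ε ℚ.* I ℚ.≤_) σ≡ εI≤σ))
          in finish uN⁺ n (λ q q< → lower-closed N (ℚP.<-≤-trans q< n∙a≤N⁻) lN⁻) N⁺≤n∙b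
      }
    where
    ε≤1 : ε ℚ.≤ 1ℚ
    ε≤1 = ℚP.≮⇒≥ λ 1<ε → ℚP.<-irrefl refl (begin-strict
      σ                    ≤⟨ undiff≤ (ℚP.<⇒≤ 0<I) (ℚP.+-comm σ I) ⟩
      I ℚ.+ σ              ≡⟨ sym (ℚP.*-identityʳ (I ℚ.+ σ)) ⟩
      (I ℚ.+ σ) ℚ.* 1ℚ     ≤⟨ ℚP.*-monoˡ-≤-nonNeg (I ℚ.+ σ)
                                ⦃ ℚ.nonNegative (ℚP.+-mono-≤ (ℚP.<⇒≤ 0<I) (ℚP.<⇒≤ 0<σ)) ⦄
                                (ℚP.<⇒≤ 1<ε) ⟩
      (I ℚ.+ σ) ℚ.* ε      <⟨ small-ε ⟩
      σ                    ∎)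
      where open ℚP.≤-Reasoning
    εI≤σ : ε ℚ.* I ℚ.≤ σ
    εI≤σ = ℚP.≤-trans
      (undiff≤ (nonNeg* (ℚP.<⇒≤ 0<σ) (ℚP.<⇒≤ 0<ε))
        (trans (cong (ℚ._+ σ ℚ.* ε) (ℚP.*-comm ε I)) (sym (ℚP.*-distribʳ-+ ε I σ))))
      (ℚP.<⇒≤ small-ε)

≤-scale : ∀ {m q c n} → 0ℚ ℚ.≤ m → 0ℚ ℚ.≤ q → 1ℚ ℚ.≤ q ℚ.* c → m ℚ.* c ℚ.≤ n → m ℚ.≤ q ℚ.* n
≤-scale {m} {q} {c} {n} 0≤m 0≤q 1≤qc mc≤n = begin
  m                    ≡⟨ sym (ℚP.*-identityʳ m) ⟩
  m ℚ.* 1ℚ             ≤⟨ ℚP.*-monoˡ-≤-nonNeg m ⦃ ℚ.nonNegative 0≤m ⦄ 1≤qc ⟩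
  m ℚ.* (q ℚ.* c)      ≡⟨ *-swap m q c ⟩
  q ℚ.* (m ℚ.* c)      ≤⟨ ℚP.*-monoˡ-≤-nonNeg q ⦃ ℚ.nonNegative 0≤q ⦄ mc≤n ⟩
  q ℚ.* n              ∎
  where open ℚP.≤-Reasoning

proposition1p2 : (N u : ℝ) → u ≤ N → (1≤u : 1ℝ ≤ u) → (1<N : 1ℝ < N) →
    (M : ℕ) → IsFloor (N / u [ 1≤x⇒0<x u 1≤u ]) M →
    (A : Subset M) →
    1ℝ / u [ 1≤x⇒0<x u 1≤u ] + 1ℝ / (√ N - 1ℝ) [ 1<x⇒0<√x-1 N 1<N ] < fromℚ (∑1/ A) →
    ∃ λ (k : ℕ) → 1 ℕ.≤ k × (∃ λ (a : Fin k → Fin M) →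
    (∀ i → a i ∈ A) ×
    N - fromℕ k < fromℕ (ℕΣ.sum λ i → value (a i)) ×
    fromℕ (ℕΣ.sum λ i → value (a i)) ≤ N)
proposition1p2 N u _ 1≤u 1<N@(_ , 1<l , ll) M (M≤N/u , _) A
  (q , (q₁ , q₂ , uq₁ , uq₂ , q₁+q₂<q) , q<Σ) =
  let k , f , f∈A , f-mono , f-sum = enumerate A
      -- Unfolding the two quotients gives `c` below `u` with `q₁ * c > 1` and `c₂` below `√ N - 1`
      -- with `q₂ * c₂ > 1`.
      _ , c , 1<a₁ , 0<c , lc , a₁<q₁c = upper-/ 1ℝ u (1≤x⇒0<x u 1≤u) q₁ uq₁
      _ , c₂ , 1<a₂ , 0<c₂ , lc₂ , a₂<q₂c₂ = upper-/ 1ℝ (√ N - 1ℝ) (1<x⇒0<√x-1 N 1<N) q₂ uq₂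
      r , c₂<r , r²<N = lower-√-1 N 0<c₂ lc₂
      1<q₁c = ℚP.<-trans 1<a₁ a₁<q₁c
      1<q₂c₂ = ℚP.<-trans 1<a₂ a₂<q₂c₂
      0<q₁ = pos-factor {q₁} 0<c (ℚP.<-trans 0<1 1<q₁c)
      0<q₂ = pos-factor {q₂} 0<c₂ (ℚP.<-trans 0<1 1<q₂c₂)
      q₁+q₂<I = ℚP.<-trans q₁+q₂<q q<Σ
      0<I = ℚP.<-trans (ℚP.+-mono-< 0<q₁ 0<q₂) q₁+q₂<I
      0<σ = diff q₁+q₂<I
      ε , 0<ε , small-ε = small (ℚP.+-mono-≤ (ℚP.<⇒≤ 0<I) (ℚP.<⇒≤ 0<σ)) 0<σ
      -- The approximation of `N` starts at `(r + 1)²`, so that its lower end `N⁻` stays above this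
      -- square.
      _ , _ , r²≤N⁻ , lN⁻ , uN⁺ , N⁺≤N⁻+ε = approximate N r²<N 0<ε
      0<N : ∀ {q} → Upper N q → 0ℚ ℚ.< q
      0<N uq = ℚP.<-trans (ℚP.<-trans 0<1 1<l) (lower<upper N ll uq)
  in Solution.conclude N A f f∈A f-mono (below-N N u 1≤u M≤N/u 1<N) 0<N {q₁ = q₁} {q₂}
    (f-sum (λ i → ℤ.+ 1 ℚ./ value i)) refl 0<I 0<σ (ℚP.<-trans 0<c₂ c₂<r)
    (ℚP.<-trans 1<q₂c₂ (ℚP.*-monoʳ-<-pos q₂ ⦃ ℚ.positive 0<q₂ ⦄ c₂<r))
    0<ε small-ε r²≤N⁻ lN⁻ uN⁺ N⁺≤N⁻+ε
    (≤-scale {q = q₁} {c} (fromNat-nonNeg M) (ℚP.<⇒≤ 0<q₁) (ℚP.<⇒≤ 1<q₁c)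
      (*c≤ N u 1≤u M≤N/u 0<c lc (0<N uN⁺) uN⁺))
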